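{- There exists a semi-streaming $4.2819$-approximation algorithm for maximizing a non-negative submodular function $f$ subject to a cardinality constraint that assumes (i) value oracle access to the multilinear extension $F$ of $f$, and (ii) access to an estimate $\tau$ of $f(OPT)$ such that $\frac{9999}{10000}\cdot f(OPT)\le\tau\le f(OPT)$. The algorithm stores at most $O(k)$ elements.
   Context: Problem: given a finite ground set $N$, a non-negative submodular function $f\colon 2^N\to\mathbb{R}_{\ge 0}$ and a positive integer $k$, find $S\subseteq N$ with $|S|\le k$ maximizing $f(S)$; $OPT$ denotes an optimal solution. The multilinear extension of $f$ is $F(x)=\mathbb{E}[f(R(x))]=\sum_{A\subseteq N} f(A)\prod_{u\in A}x_u\prod_{u\notin A}(1-x_u)$ for $x\in[0,1]^N$, where $R(x)$ is a random set containing each $u$ independently with probability $x_u$; a value oracle for $F$ returns $F(x)$ for a given $x$. A (possibly randomized) algorithm is a $\beta$-approximation if its output $S$ is always feasible and $\mathbb{E}[f(S)]\ge f(OPT)/\beta$. In the data stream model the elements of $N$ arrive one at a time in an arbitrary order and are processed in a single pass; a semi-streaming algorithm uses memory $O(k\cdot\mathrm{polylog}(k,|N|))$. -}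

module Defs where

open import Algebra.Bundles using (CommutativeRing; Semiring)
import Algebra.Definitions.RawSemiring as RawSemiringDefs
open import Data.Bool.Base using (Bool; if_then_else_)
open import Data.Fin.Base using (Fin)
open import Data.Fin.Permutation using (Permutation′; _⟨$⟩ʳ_)
open import Data.Fin.Properties using (_≟_)
open import Data.Fin.Subset using (Subset; inside; outside; ∣_∣; ⁅_⁆; _∩_; _∪_) renaming (⊥ to ∅)
open import Data.Integer.Base using (ℤ; +_; -[1+_])
open import Data.List.Base as List using (List; []; _∷_; _++_)
open import Data.Nat.Base as ℕ using (ℕ; suc)
open import Data.Nat.Logarithm using (⌈log₂_⌉)
open import Data.Product.Base using (_×_)
open import Data.Rational.Base as ℚ using (ℚ; 0ℚ; 1ℚ; ½; ↥_; ↧_)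
open import Data.Unit.Base using (⊤)
open import Data.Vec.Base as Vec using (Vec; []; _∷_; lookup; removeAt)
open import Function.Definitions using (Injective)
open import Level using (Level; _⊔_) renaming (suc to lsuc)
open import Relation.Binary.Core using (Rel)
open import Relation.Binary.PropositionalEquality.Core using (_≡_)
open import Relation.Binary.Structures using (IsDecTotalOrder)
open import Relation.Nullary.Decidable.Core using (does)
open import Relation.Nullary.Negation.Core using (¬_)

-- The library has no real numbers.  All real quantities (values of f, the
-- estimate τ, expectations) live in an arbitrary ordered field with decidable
-- order.  Classically ℝ is such a field; ℚ is one constructively.
record OrderedField (c ℓ₁ ℓ₂ : Level) : Set (lsuc (c ⊔ ℓ₁ ⊔ ℓ₂)) where
  infix  4 _≤_
  infix  9 _⁻¹
  field
    commutativeRing : CommutativeRing c ℓ₁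
  open CommutativeRing commutativeRing public
  field
    _≤_             : Rel Carrier ℓ₂
    isDecTotalOrder : IsDecTotalOrder _≈_ _≤_
    +-monoˡ-≤       : ∀ z {x y} → x ≤ y → x + z ≤ y + z
    *-nonNegative   : ∀ {x y} → 0# ≤ x → 0# ≤ y → 0# ≤ x * y
    0≉1             : ¬ (0# ≈ 1#)
    -- total, but unconstrained at 0
    _⁻¹             : Carrier → Carrier
    *-inverseʳ      : ∀ x → ¬ (x ≈ 0#) → x * x ⁻¹ ≈ 1#

  open IsDecTotalOrder isDecTotalOrder public using (_≤?_)
  open RawSemiringDefs (Semiring.rawSemiring semiring) public
    using (product) renaming (_×_ to _·_)

  fromℤ : ℤ → Carrier
  fromℤ (+ n)      = n · 1#
  fromℤ (-[1+ n ]) = - (suc n · 1#)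

  fromℚ : ℚ → Carrier
  fromℚ q = fromℤ (↥ q) * fromℤ (↧ q) ⁻¹

-- The ground set is Fin n; its subsets are the library's Subset n.
subsets : (n : ℕ) → List (Subset n)
subsets 0       = [] ∷ []
subsets (suc n) = List.map (outside ∷_) (subsets n) ++ List.map (inside ∷_) (subsets n)

module SetFunctions {c ℓ₁ ℓ₂} (𝕂 : OrderedField c ℓ₁ ℓ₂) where
  open OrderedField 𝕂

  SetFunction : ℕ → Set c
  SetFunction n = Subset n → Carrier

  NonNegative : ∀ {n} → SetFunction n → Set ℓ₂
  NonNegative f = ∀ A → 0# ≤ f A

  Submodular : ∀ {n} → SetFunction n → Set ℓ₂
  Submodular f = ∀ A B → f (A ∩ B) + f (A ∪ B) ≤ f A + f B

  Feasible : ∀ {n} → ℕ → Subset n → Set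
  Feasible k S = ∣ S ∣ ℕ.≤ k

  IsOptimal : ∀ {n} → SetFunction n → ℕ → Subset n → Set ℓ₂
  IsOptimal f k OPT = Feasible k OPT × (∀ S → Feasible k S → f S ≤ f OPT)

  IsEstimate : ℚ → Carrier → Carrier → Set ℓ₂
  IsEstimate ρ τ v = fromℚ ρ * v ≤ τ × τ ≤ v

  -- the probability that R(x) equals A
  probability : ∀ {n} → (Fin n → Carrier) → Subset n → Carrier
  probability x A = product (λ u → if lookup A u then x u else (1# - x u))

  multilinear : ∀ {n} → SetFunction n → (Fin n → Carrier) → Carrier
  multilinear {n} f x = List.foldr _+_ 0# (List.map (λ A → f A * probability x A) (subsets n))

record UnitInterval : Set where
  constructor unit
  field
    value : ℚ
    0≤    : 0ℚ ℚ.≤ value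
    ≤1    : value ℚ.≤ 1ℚ

-- A single-pass streaming algorithm is a machine whose memory consists of
--   * m slots, each storing one element of the ground set,
--   * r registers, each storing one answer of the oracle for F,
--   * a control state, drawn from State m r.
-- Elements are opaque: they can be kept, forgotten, queried and output, but
-- their names are not visible to the control.  Real numbers occur only as the
-- oracle's answers and as the input τ, and influence the control only through
-- tests; no arithmetic result can be written back to a register, so registers
-- cannot be used to encode control information.
-- Each instruction names its successor state(s).
data Instruction (State : ℕ → ℕ → Set) : ℕ → ℕ → Set where
  -- take the next stream element into a new slot, or learn that there is none
  next   : ∀ {m r} → (arrived : State (suc m) r) (exhausted : State m r) → Instruction State m r
  -- empty one slot / one register
  forget : ∀ {m r} → Fin (suc m) → State m r → Instruction State (suc m) r
  erase  : ∀ {m r} → Fin (suc r) → State m r → Instruction State m (suc r)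
  -- ask for F(x), where x is given on the stored elements and is 0 elsewhere
  query  : ∀ {m r} → Vec UnitInterval m → State m (suc r) → Instruction State m r
  -- is  a τ + Σᵢ bᵢ · registerᵢ ≥ 0 ?
  test   : ∀ {m r} → (a : ℤ) (b : Vec ℤ r) → (yes no : State m r) → Instruction State m r
  -- flip a fair coin
  toss   : ∀ {m r} → (heads tails : State m r) → Instruction State m r
  -- output the elements in the selected slots
  halt   : ∀ {m r} → Subset m → Instruction State m r

-- One algorithm serves all inputs.  It is told k, but not the size n of the
-- ground set.  The injective encoding determines how many bits a control
-- state occupies.
record StreamingAlgorithm : Set₁ where
  field
    State          : ℕ → ℕ → Set
    code           : ∀ {m r} → State m r → List Bool
    code-injective : ∀ {m r} → Injective _≡_ _≡_ (code {m} {r})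
    initial        : (k : ℕ) → State 0 0
    program        : (k : ℕ) → ∀ {m r} → State m r → Instruction State m r

module Execution
  {c ℓ₁ ℓ₂} (𝕂 : OrderedField c ℓ₁ ℓ₂)
  (alg : StreamingAlgorithm) {n : ℕ} (k : ℕ)
  (F : (Fin n → OrderedField.Carrier 𝕂) → OrderedField.Carrier 𝕂) (τ : OrderedField.Carrier 𝕂)
  where

  open OrderedField 𝕂
  open StreamingAlgorithm alg

  record Configuration : Set c where
    constructor ⟨_,_,_,_⟩
    field
      {#slots #registers} : ℕ
      state     : State #slots #registers
      slots     : Vec (Fin n) #slots
      registers : Vec Carrier #registers
      unread    : List (Fin n)

    storedElements : ℕ
    storedElements = #slots

    -- A stored element costs 1 + ⌈log₂ n⌉, an oracle answer costs one word,
    -- the control state costs its length in bits.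
    memory : ℕ
    memory = #slots ℕ.* (1 ℕ.+ ⌈log₂ n ⌉) ℕ.+ #registers ℕ.+ List.length (code state)

  -- Stream elements are distinct, hence so are the contents of the slots.
  point : ∀ {m} → Vec (Fin n) m → Vec UnitInterval m → Fin n → Carrier
  point []       []       u = 0#
  point (e ∷ es) (x ∷ xs) u =
    if does (u ≟ e) then fromℚ (UnitInterval.value x) else point es xs u

  selection : ∀ {m} → Vec (Fin n) m → Subset m → Subset n
  selection []       []            = ∅
  selection (e ∷ es) (inside  ∷ p) = ⁅ e ⁆ ∪ selection es p
  selection (e ∷ es) (outside ∷ p) = selection es p

  combination : ∀ {r} → Vec ℤ r → Vec Carrier r → Carrier
  combination []       []       = 0#
  combination (b ∷ bs) (v ∷ vs) = fromℤ b * v + combination bs vs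

  data Outcome : Set c where
    output   : Subset n → Outcome
    continue : Configuration → Outcome
    branch   : (heads tails : Configuration) → Outcome

  execute : ∀ {m r} → Instruction State m r →
            Vec (Fin n) m → Vec Carrier r → List (Fin n) → Outcome
  execute (next a e)      es vs []       = continue ⟨ e , es , vs , [] ⟩
  execute (next a e)      es vs (u ∷ us) = continue ⟨ a , u ∷ es , vs , us ⟩
  execute (forget i q)    es vs us       = continue ⟨ q , removeAt es i , vs , us ⟩
  execute (erase i q)     es vs us       = continue ⟨ q , es , removeAt vs i , us ⟩
  execute (query x q)     es vs us       = continue ⟨ q , es , F (point es x) ∷ vs , us ⟩
  execute (test a b y z)  es vs us       =
    continue ⟨ (if does (0# ≤? fromℤ a * τ + combination b vs) then y else z) , es , vs , us ⟩
  execute (toss h t)      es vs us       = branch ⟨ h , es , vs , us ⟩ ⟨ t , es , vs , us ⟩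
  execute (halt p)        es vs us       = output (selection es p)

  step : Configuration → Outcome
  step ⟨ q , es , vs , us ⟩ = execute (program k q) es vs us

  -- The (finite) tree of all computations over the coin tosses.
  data Run : Outcome → Set c where
    output   : ∀ S → Run (output S)
    continue : ∀ {γ} → Run (step γ) → Run (continue γ)
    branch   : ∀ {γ δ} → Run (step γ) → Run (step δ) → Run (branch γ δ)

  start : Permutation′ n → Outcome
  start σ = continue ⟨ initial k , [] , [] , List.tabulate (σ ⟨$⟩ʳ_) ⟩

  Throughout : ∀ {o} → (Configuration → Set) → Run o → Set
  Throughout P (output S)           = ⊤
  Throughout P (continue {γ} t)     = P γ × Throughout P t
  Throughout P (branch {γ} {δ} t s) = (P γ × Throughout P t) × (P δ × Throughout P s)

  AlwaysOutputs : ∀ {o} → (Subset n → Set) → Run o → Set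
  AlwaysOutputs P (output S)   = P S
  AlwaysOutputs P (continue t) = AlwaysOutputs P t
  AlwaysOutputs P (branch t s) = AlwaysOutputs P t × AlwaysOutputs P s

  expectation : ∀ {o} → (Subset n → Carrier) → Run o → Carrier
  expectation g (output S)   = g S
  expectation g (continue t) = expectation g t
  expectation g (branch t s) = fromℚ ½ * (expectation g t + expectation g s)

-- The 1 keeps the polylogarithm positive when k, n ≤ 1.
semiStreamingBound : (C d k n : ℕ) → ℕ
semiStreamingBound C d k n = C ℕ.* k ℕ.* (1 ℕ.+ ⌈log₂ k ⌉ ℕ.+ ⌈log₂ n ⌉) ℕ.^ d

-- The behaviour of the algorithm on the stream σ 0, σ 1, …, σ (n - 1).
record Guarantee
  {c ℓ₁ ℓ₂} (𝕂 : OrderedField c ℓ₁ ℓ₂) (alg : StreamingAlgorithm) (β : ℚ) (B C d : ℕ)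
  {n : ℕ} (f : SetFunctions.SetFunction 𝕂 n) (k : ℕ) (OPT : Subset n)
  (τ : OrderedField.Carrier 𝕂) (σ : Permutation′ n) : Set (c ⊔ ℓ₂) where
  open OrderedField 𝕂
  open SetFunctions 𝕂
  open Execution 𝕂 alg k (multilinear f) τ
  field
    run           : Run (start σ)
    feasible      : AlwaysOutputs (Feasible k) run
    approximation : f OPT * fromℚ β ⁻¹ ≤ expectation f run
    semiStreaming : Throughout (λ γ → Configuration.memory γ ℕ.≤ semiStreamingBound C d k n) run
    O[k]-elements : Throughout (λ γ → Configuration.storedElements γ ℕ.≤ B ℕ.* k) run

{-# OPTIONS --safe #-}

-- Four disjoint sets S are grown greedily: an arriving element u joins the
-- first S with f(S + u) − f(S) ≥ τ/(4k), and is discarded if there is none.  A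
-- set that reaches size k has value at least τ/4 and is output.  Otherwise let
-- M be the best value of a feasible set of stored elements, found by exhaustive
-- search.  With Y the stored part of OPT, every S satisfies
--   f(S ∪ OPT) ≤ f(S ∪ Y) + k · τ/(4k) ≤ f(S) + f(Y) + τ/4 ≤ 2M + f(OPT)/4,
-- whereas disjointness of the four sets and submodularity make the sum of the
-- f(S ∪ OPT) at least 3 f(OPT); hence f(OPT) ≤ 4M.  So the ratio is
-- 4 · 10000/9999 < 4.2819, and no coin is ever tossed.
module Submission where

import Algebra.Properties.CommutativeMonoid.Mult
import Algebra.Properties.Ring
import Algebra.Properties.Semiring.Mult
import Algebra.Solver.Ring.NaturalCoefficients.Default
open import Data.Bool.Base using (Bool; true; false; if_then_else_)
import Data.Bool.Properties as Bool
open import Data.Empty using (⊥-elim)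
open import Data.Fin.Base using (Fin; zero; suc)
open import Data.Fin.Permutation using (Permutation′; _⟨$⟩ʳ_; _⟨$⟩ˡ_; inverseʳ; inverseˡ)
import Data.Fin.Properties as Fin
open import Data.Fin.Subset using (Subset; inside; outside; ∣_∣; ⁅_⁆; _∩_; _∪_; _∈_; _∉_; _⊆_; _─_; ⋃; ⊤)
  renaming (⊥ to ∅; _-_ to _∖_)
open import Data.Fin.Subset.Properties
open import Data.Integer.Base as ℤ using (+_; -[1+_])
open import Data.List.Base as List using (List; []; _∷_; _++_)
import Data.List.Membership.Propositional as List
import Data.List.Membership.Propositional.Properties as List
import Data.List.Relation.Unary.All as All
import Data.List.Relation.Unary.AllPairs as AllPairs
import Data.List.Relation.Unary.AllPairs.Properties as AllPairsₚ
import Data.List.Relation.Unary.Any as Any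
open import Data.List.Relation.Unary.Unique.Propositional using (Unique)
import Data.List.Relation.Unary.Unique.Propositional.Properties as Unique
open import Data.Maybe.Base as Maybe using (Maybe; just; nothing; maybe′)
open import Data.Nat.Base as ℕ using (ℕ; zero; suc; NonZero)
import Data.Nat.ListAction as ListAction
open import Data.Nat.Logarithm using (⌈log₂_⌉)
import Data.Nat.Properties as ℕ
import Data.Nat.Tactic.RingSolver as ℕ
open import Data.Product.Base using (_,_; _×_; proj₁; proj₂; ∃; Σ-syntax)
import Data.Product.Properties as Product
open import Data.Rational.Base using (0ℚ; 1ℚ; _/_; ↥_; ↧_)
import Data.Rational.Properties as ℚ
open import Data.Sum.Base using (_⊎_; inj₁; inj₂; [_,_]′)
open import Data.Unit.Base using (tt)
open import Data.Vec.Base as Vec using (Vec; []; _∷_; lookup)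
import Data.Vec.Properties as Vec
import Data.Vec.Relation.Unary.All as VecAll
import Data.Vec.Relation.Unary.All.Properties as VecAllₚ
import Data.Vec.Relation.Unary.AllPairs as VecAllPairs
import Data.Vec.Relation.Unary.Unique.Propositional as Vec
import Data.Vec.Relation.Unary.Unique.Propositional.Properties as VecUnique
open import Function.Base using (_∘_; id)
open import Level using (_⊔_)
open import Relation.Binary.Bundles using (Poset)
open import Relation.Binary.Definitions using (DecidableEquality)
open import Relation.Binary.PropositionalEquality as ≡ using (_≡_; _≢_)
import Relation.Binary.Reasoning.PartialOrder
open import Relation.Binary.Structures using (IsDecTotalOrder)
open import Relation.Nullary using (¬_; yes; no; Dec; does)
open import Relation.Nullary.Decidable using (from-yes)
open import Defs
open All using (All; []; _∷_)
open AllPairs using (AllPairs; []; _∷_)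
open VecAllPairs using ([]; _∷_)

module OrderedFieldProperties {c ℓ₁ ℓ₂} (𝕂 : OrderedField c ℓ₁ ℓ₂) where
  open OrderedField 𝕂 public hiding (zero)
  open IsDecTotalOrder isDecTotalOrder public
    using (total) renaming (refl to ≤-refl; reflexive to ≤-reflexive; trans to ≤-trans; antisym to ≤-antisym)
  open Algebra.Properties.Ring ring public
    using (-0#≈0#; -1*x≈-x; -‿involutive)
  open Algebra.Properties.Semiring.Mult semiring public
    using (×-assoc-*; ×-congʳ; ×-congˡ; ×-assocˡ)
  open Algebra.Properties.CommutativeMonoid.Mult +-commutativeMonoid public
    using (×-distrib-+)
  open Algebra.Solver.Ring.NaturalCoefficients.Default commutativeSemiring public
    using (solve; _:+_; _:*_; _:=_; con)

  poset : Poset c ℓ₁ ℓ₂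
  poset = record { isPartialOrder = IsDecTotalOrder.isPartialOrder isDecTotalOrder }

  open Relation.Binary.Reasoning.PartialOrder poset public

  ≰⇒≥ : ∀ {x y} → ¬ (x ≤ y) → y ≤ x
  ≰⇒≥ {x} {y} x≰y with total x y
  ... | inj₁ x≤y = ⊥-elim (x≰y x≤y)
  ... | inj₂ y≤x = y≤x

  +-monoʳ-≤ : ∀ z {x y} → x ≤ y → z + x ≤ z + y
  +-monoʳ-≤ z {x} {y} x≤y = begin
    z + x  ≈⟨ +-comm z x ⟩
    x + z  ≤⟨ +-monoˡ-≤ z x≤y ⟩
    y + z  ≈⟨ +-comm y z ⟩
    z + y  ∎

  +-mono-≤ : ∀ {w x y z} → w ≤ x → y ≤ z → w + y ≤ x + z
  +-mono-≤ {x = x} {y} w≤x y≤z = ≤-trans (+-monoˡ-≤ y w≤x) (+-monoʳ-≤ x y≤z)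

  x+[-y+y]≈x : ∀ x y → (x + - y) + y ≈ x
  x+[-y+y]≈x x y = trans (+-assoc x (- y) y) (trans (+-congˡ (-‿inverseˡ y)) (+-identityʳ x))

  +-cancelʳ-≤ : ∀ z {x y} → x + z ≤ y + z → x ≤ y
  +-cancelʳ-≤ z {x} {y} x+z≤y+z = begin
    x              ≈⟨ cancel x ⟨
    (x + z) + - z  ≤⟨ +-monoˡ-≤ (- z) x+z≤y+z ⟩
    (y + z) + - z  ≈⟨ cancel y ⟩
    y              ∎
    where
    cancel : ∀ w → (w + z) + - z ≈ w
    cancel w = trans (+-assoc w z (- z)) (trans (+-congˡ (-‿inverseʳ z)) (+-identityʳ w))

  x≤x+y : ∀ x {y} → 0# ≤ y → x ≤ x + y
  x≤x+y x {y} 0≤y = begin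
    x       ≈⟨ +-identityʳ x ⟨
    x + 0#  ≤⟨ +-monoʳ-≤ x 0≤y ⟩
    x + y   ∎

  x≤0⇒0≤-x : ∀ {x} → x ≤ 0# → 0# ≤ - x
  x≤0⇒0≤-x {x} x≤0 = begin
    0#        ≈⟨ -‿inverseʳ x ⟨
    x + - x   ≤⟨ +-monoˡ-≤ (- x) x≤0 ⟩
    0# + - x  ≈⟨ +-identityˡ (- x) ⟩
    - x       ∎

  0≤1 : 0# ≤ 1#
  0≤1 with total 0# 1#
  ... | inj₁ 0≤1 = 0≤1
  ... | inj₂ 1≤0 = begin
    0#           ≤⟨ *-nonNegative (x≤0⇒0≤-x 1≤0) (x≤0⇒0≤-x 1≤0) ⟩
    - 1# * - 1#  ≈⟨ -1*x≈-x (- 1#) ⟩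
    - - 1#       ≈⟨ -‿involutive 1# ⟩
    1#           ∎

  x≤y⇒0≤y-x : ∀ {x y} → x ≤ y → 0# ≤ y + - x
  x≤y⇒0≤y-x {x} {y} x≤y = begin
    0#       ≈⟨ -‿inverseʳ x ⟨
    x + - x  ≤⟨ +-monoˡ-≤ (- x) x≤y ⟩
    y + - x  ∎

  *-monoˡ-≤ : ∀ {z x y} → 0# ≤ z → x ≤ y → z * x ≤ z * y
  *-monoˡ-≤ {z} {x} {y} 0≤z x≤y = begin
    z * x                    ≤⟨ x≤x+y (z * x) (*-nonNegative 0≤z (x≤y⇒0≤y-x x≤y)) ⟩
    z * x + z * (y + - x)    ≈⟨ distribˡ z x (y + - x) ⟨
    z * (x + (y + - x))      ≈⟨ *-congˡ (+-comm x (y + - x)) ⟩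
    z * ((y + - x) + x)      ≈⟨ *-congˡ (x+[-y+y]≈x y x) ⟩
    z * y                    ∎

  *-cancelˡ-≈ : ∀ z {x y} → ¬ (z ≈ 0#) → z * x ≈ z * y → x ≈ y
  *-cancelˡ-≈ z {x} {y} z≉0 zx≈zy = trans (sym (undo x)) (trans (*-congˡ zx≈zy) (undo y))
    where
    undo : ∀ w → z ⁻¹ * (z * w) ≈ w
    undo w = trans (sym (*-assoc (z ⁻¹) z w))
      (trans (*-congʳ (trans (*-comm (z ⁻¹) z) (*-inverseʳ z z≉0))) (*-identityˡ w))

  *-cancelˡ-≤ : ∀ z {x y} → 0# ≤ z → ¬ (z ≈ 0#) → z * x ≤ z * y → x ≤ y
  *-cancelˡ-≤ z {x} {y} 0≤z z≉0 zx≤zy with total x y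
  ... | inj₁ x≤y = x≤y
  ... | inj₂ y≤x = ≤-reflexive (*-cancelˡ-≈ z z≉0 (≤-antisym zx≤zy (*-monoˡ-≤ 0≤z y≤x)))

  ·-nonNegative : ∀ n {x} → 0# ≤ x → 0# ≤ n · x
  ·-nonNegative zero    0≤x = ≤-refl
  ·-nonNegative (suc n) {x} 0≤x = ≤-trans 0≤x (x≤x+y x (·-nonNegative n 0≤x))

  ·-monoʳ-≤ : ∀ n {x y} → x ≤ y → n · x ≤ n · y
  ·-monoʳ-≤ zero    x≤y = ≤-refl
  ·-monoʳ-≤ (suc n) x≤y = +-mono-≤ x≤y (·-monoʳ-≤ n x≤y)

  ·-monoˡ-≤ : ∀ {m n x} → 0# ≤ x → m ℕ.≤ n → m · x ≤ n · x
  ·-monoˡ-≤ {n = n} 0≤x ℕ.z≤n     = ·-nonNegative n 0≤x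
  ·-monoˡ-≤ {x = x} 0≤x (ℕ.s≤s p) = +-monoʳ-≤ x (·-monoˡ-≤ 0≤x p)

  n·x≈n·1*x : ∀ n x → n · x ≈ n · 1# * x
  n·x≈n·1*x n x = sym (trans (×-assoc-* n 1# x) (×-congʳ n (*-identityˡ x)))

  n·1≉0 : ∀ n → .{{ℕ.NonZero n}} → ¬ (n · 1# ≈ 0#)
  n·1≉0 (suc n) n·1≈0 = 0≉1 (≤-antisym 0≤1
    (≤-trans (x≤x+y 1# (·-nonNegative n 0≤1)) (≤-reflexive n·1≈0)))

  ·-cancelˡ-≤ : ∀ n {x y} → .{{ℕ.NonZero n}} → n · x ≤ n · y → x ≤ y
  ·-cancelˡ-≤ n {x} {y} nx≤ny = *-cancelˡ-≤ (n · 1#) (·-nonNegative n 0≤1) (n·1≉0 n) (begin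
    n · 1# * x  ≈⟨ n·x≈n·1*x n x ⟨
    n · x       ≤⟨ nx≤ny ⟩
    n · y       ≈⟨ n·x≈n·1*x n y ⟩
    n · 1# * y  ∎)

  x*y⁻¹*y≈x : ∀ x {y} → ¬ (y ≈ 0#) → (x * y ⁻¹) * y ≈ x
  x*y⁻¹*y≈x x {y} y≉0 = trans (*-assoc x (y ⁻¹) y)
    (trans (*-congˡ (trans (*-comm (y ⁻¹) y) (*-inverseʳ y y≉0))) (*-identityʳ x))

  fromℚ-1 : fromℚ 1ℚ ≈ 1#
  fromℚ-1 = trans (*-inverseʳ _ (n·1≉0 1)) refl

  fromℤ-neg : ∀ n → fromℤ (ℤ.- (+ n)) ≈ - (n · 1#)
  fromℤ-neg zero    = sym -0#≈0#
  fromℤ-neg (suc n) = refl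

  fromℚ*x≤y⇒a·x≤b·y : ∀ q a b {x y} → .{{ℕ.NonZero b}} → ↥ q ≡ + a → ↧ q ≡ + b →
    fromℚ q * x ≤ y → a · x ≤ b · y
  fromℚ*x≤y⇒a·x≤b·y q a b {x} {y} ↥q≡a ↧q≡b qx≤y = begin
    a · x                ≈⟨ n·x≈n·1*x a x ⟩
    α * x                ≈⟨ *-congʳ (x*y⁻¹*y≈x α (n·1≉0 b)) ⟨
    ((α * δ ⁻¹) * δ) * x ≡⟨ ≡.cong₂ (λ n d → ((fromℤ n * fromℤ d ⁻¹) * δ) * x) ↥q≡a ↧q≡b ⟨
    (fromℚ q * δ) * x    ≈⟨ *-congʳ (*-comm (fromℚ q) δ) ⟩
    (δ * fromℚ q) * x    ≈⟨ *-assoc δ (fromℚ q) x ⟩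
    δ * (fromℚ q * x)    ≤⟨ *-monoˡ-≤ (·-nonNegative b 0≤1) qx≤y ⟩
    δ * y                ≈⟨ n·x≈n·1*x b y ⟨
    b · y                ∎
    where
    α = a · 1#
    δ = b · 1#

  b·x≤a·y⇒x*fromℚ⁻¹≤y : ∀ q a b {x y} → .{{ℕ.NonZero a}} → .{{ℕ.NonZero b}} →
    ↥ q ≡ + a → ↧ q ≡ + b → b · x ≤ a · y → x * fromℚ q ⁻¹ ≤ y
  b·x≤a·y⇒x*fromℚ⁻¹≤y q a b {x} {y} ↥q≡a ↧q≡b bx≤ay = *-cancelˡ-≤ α (·-nonNegative a 0≤1) (n·1≉0 a) (begin
    α * (x * κ ⁻¹)        ≈⟨ *-congʳ κδ≈α ⟨
    (κ * δ) * (x * κ ⁻¹)  ≈⟨ solve 4 (λ q δ x r → (q :* δ) :* (x :* r) := (q :* r) :* (δ :* x)) refl κ δ x (κ ⁻¹) ⟩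
    (κ * κ ⁻¹) * (δ * x)  ≈⟨ *-congʳ (*-inverseʳ κ κ≉0) ⟩
    1# * (δ * x)          ≈⟨ *-identityˡ (δ * x) ⟩
    δ * x                 ≈⟨ n·x≈n·1*x b x ⟨
    b · x                 ≤⟨ bx≤ay ⟩
    a · y                 ≈⟨ n·x≈n·1*x a y ⟩
    α * y                 ∎)
    where
    α = a · 1#
    δ = b · 1#
    κ = fromℚ q
    κδ≈α : κ * δ ≈ α
    κδ≈α = trans (reflexive (≡.cong₂ (λ n d → (fromℤ n * fromℤ d ⁻¹) * δ) ↥q≡a ↧q≡b)) (x*y⁻¹*y≈x α (n·1≉0 b))
    κ≉0 : ¬ (κ ≈ 0#)
    κ≉0 κ≈0 = n·1≉0 a (trans (sym κδ≈α) (trans (*-congʳ κ≈0) (zeroˡ δ)))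

  fromℚ-nonNegative : ∀ q a b → .{{ℕ.NonZero b}} → ↥ q ≡ + a → ↧ q ≡ + b → 0# ≤ fromℚ q
  fromℚ-nonNegative q a b ↥q≡a ↧q≡b = *-cancelˡ-≤ δ (·-nonNegative b 0≤1) (n·1≉0 b) (begin
    δ * 0#                        ≈⟨ zeroʳ δ ⟩
    0#                            ≤⟨ ·-nonNegative a 0≤1 ⟩
    a · 1#                        ≈⟨ x*y⁻¹*y≈x (a · 1#) (n·1≉0 b) ⟨
    (a · 1# * δ ⁻¹) * δ           ≡⟨ ≡.cong₂ (λ n d → (fromℤ n * fromℤ d ⁻¹) * δ) ↥q≡a ↧q≡b ⟨
    fromℚ q * δ                   ≈⟨ *-comm (fromℚ q) δ ⟩
    δ * fromℚ q                   ∎)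
    where δ = b · 1#

  ·-rescale-≤ : ∀ p q a b {x y} → .{{ℕ.NonZero p}} → 0# ≤ y →
    a ℕ.* q ℕ.≤ p ℕ.* b → p · x ≤ q · y → a · x ≤ b · y
  ·-rescale-≤ p q a b {x} {y} 0≤y aq≤pb px≤qy = ·-cancelˡ-≤ p (begin
    p · (a · x)    ≈⟨ ×-assocˡ x p a ⟩
    (p ℕ.* a) · x  ≡⟨ ≡.cong (_· x) (ℕ.*-comm p a) ⟩
    (a ℕ.* p) · x  ≈⟨ ×-assocˡ x a p ⟨
    a · (p · x)    ≤⟨ ·-monoʳ-≤ a px≤qy ⟩
    a · (q · y)    ≈⟨ ×-assocˡ y a q ⟩
    (a ℕ.* q) · y  ≤⟨ ·-monoˡ-≤ 0≤y aq≤pb ⟩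
    (p ℕ.* b) · y  ≈⟨ ×-assocˡ y p b ⟨
    p · (b · y)    ∎)

  approximation-ratio : ∀ ρ β c d a b {τ v M} →
    .{{ℕ.NonZero c}} → .{{ℕ.NonZero d}} → .{{ℕ.NonZero a}} → .{{ℕ.NonZero b}} →
    ↥ ρ ≡ + c → ↧ ρ ≡ + d → ↥ β ≡ + a → ↧ β ≡ + b → b ℕ.* (d ℕ.* 4) ℕ.≤ c ℕ.* a →
    0# ≤ M → fromℚ ρ * v ≤ τ → τ ≤ 4 · M → v * fromℚ β ⁻¹ ≤ M
  approximation-ratio ρ β c d a b {τ} {v} {M} ↥ρ ↧ρ ↥β ↧β 4bd≤ca 0≤M ρv≤τ τ≤4M =
    b·x≤a·y⇒x*fromℚ⁻¹≤y β a b ↥β ↧β (·-rescale-≤ c (d ℕ.* 4) b a 0≤M 4bd≤ca (begin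
      c · v          ≤⟨ fromℚ*x≤y⇒a·x≤b·y ρ c d ↥ρ ↧ρ ρv≤τ ⟩
      d · τ          ≤⟨ ·-monoʳ-≤ d τ≤4M ⟩
      d · (4 · M)    ≈⟨ ×-assocˡ M d 4 ⟩
      (d ℕ.* 4) · M  ∎))

  estimate⇒ratio : ∀ {τ v M} → 0# ≤ M → fromℚ (+ 9999 / 10000) * v ≤ τ → τ ≤ 4 · M →
                   v * fromℚ (+ 42819 / 10000) ⁻¹ ≤ M
  estimate⇒ratio = approximation-ratio (+ 9999 / 10000) (+ 42819 / 10000) 9999 10000 42819 10000
    ≡.refl ≡.refl ≡.refl ≡.refl (ℕ.≤ᵇ⇒≤ _ _ _)

  estimate-nonNegative : ∀ {τ v} → 0# ≤ v → fromℚ (+ 9999 / 10000) * v ≤ τ → 0# ≤ τ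
  estimate-nonNegative 0≤v ρv≤τ =
    ≤-trans (*-nonNegative (fromℚ-nonNegative (+ 9999 / 10000) 9999 10000 ≡.refl ≡.refl) 0≤v) ρv≤τ

Disjoint : ∀ {n} → Subset n → Subset n → Set
Disjoint A B = A ∩ B ≡ ∅

∉⇒disjoint : ∀ {n} {u : Fin n} {A} → u ∉ A → Disjoint ⁅ u ⁆ A
∉⇒disjoint {u = u} {A} u∉A = Empty-unique λ (w , w∈) →
  let (w∈u , w∈A) = x∈p∩q⁻ ⁅ u ⁆ A w∈
  in u∉A (≡.subst (_∈ A) (x∈⁅y⁆⇒x≡y u w∈u) w∈A)

x∈p─q⇒x∉q : ∀ {n} {x : Fin n} {p q} → x ∈ p ─ q → x ∉ q
x∈p─q⇒x∉q {x = zero}  {_ ∷ _} {outside ∷ _} _              ()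
x∈p─q⇒x∉q {x = suc _} {_ ∷ _} {_ ∷ _}       (Vec.there x∈) (Vec.there x∈q) = x∈p─q⇒x∉q x∈ x∈q

disjoint-∪ : ∀ {n} {A B C : Subset n} → Disjoint A B → Disjoint A C → Disjoint A (B ∪ C)
disjoint-∪ {A = A} {B} {C} A∩B A∩C = ≡.trans (∩-distribˡ-∪ A B C)
  (≡.trans (≡.cong₂ _∪_ A∩B A∩C) (∪-idem ∅))

disjoint-⋃ : ∀ {n} {A : Subset n} {Bs} → All (Disjoint A) Bs → Disjoint A (⋃ Bs)
disjoint-⋃ {A = A} []         = ∩-zeroʳ A
disjoint-⋃         (px ∷ pxs) = disjoint-∪ px (disjoint-⋃ pxs)

module MultilinearProperties {c ℓ₁ ℓ₂} (𝕂 : OrderedField c ℓ₁ ℓ₂) where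
  open OrderedFieldProperties 𝕂
  open SetFunctions 𝕂

  indicator : ∀ {n} → Subset n → Fin n → Carrier
  indicator B u = if lookup B u then 1# else 0#

  weightedSum : ∀ {n} → SetFunction n → SetFunction n → List (Subset n) → Carrier
  weightedSum f p = List.foldr _+_ 0# ∘ List.map (λ A → f A * p A)

  weightedSum-++ : ∀ {n} (f p : SetFunction n) As Bs →
    weightedSum f p (As ++ Bs) ≈ weightedSum f p As + weightedSum f p Bs
  weightedSum-++ f p []       Bs = sym (+-identityˡ _)
  weightedSum-++ f p (A ∷ As) Bs = trans (+-congˡ (weightedSum-++ f p As Bs)) (sym (+-assoc _ _ _))

  weightedSum-map : ∀ {n} (f p : SetFunction (suc n)) (q : SetFunction n) b y →
    (∀ A → p (b ∷ A) ≈ y * q A) → ∀ As →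
    weightedSum f p (List.map (b ∷_) As) ≈ y * weightedSum (f ∘ (b ∷_)) q As
  weightedSum-map f p q b y p≈ []       = sym (zeroʳ y)
  weightedSum-map f p q b y p≈ (A ∷ As) = trans
    (+-cong (*-congˡ (p≈ A)) (weightedSum-map f p q b y p≈ As))
    (solve 4 (λ v y q s → v :* (y :* q) :+ y :* s := y :* (v :* q :+ s)) refl _ y (q A) _)

  multilinear-cons : ∀ {n} (f : SetFunction (suc n)) x → multilinear f x ≈
    (1# - x zero) * multilinear (f ∘ (outside ∷_)) (x ∘ suc) + x zero * multilinear (f ∘ (inside ∷_)) (x ∘ suc)
  multilinear-cons {n} f x = trans
    (weightedSum-++ f (probability x) (List.map (outside ∷_) (subsets n)) (List.map (inside ∷_) (subsets n)))
    (+-cong (weightedSum-map f (probability x) (probability (x ∘ suc)) outside _ (λ _ → refl) (subsets n))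
            (weightedSum-map f (probability x) (probability (x ∘ suc)) inside  _ (λ _ → refl) (subsets n)))

  multilinear-vertex : ∀ {n} (f : SetFunction n) B {x} → (∀ u → x u ≈ indicator B u) → multilinear f x ≈ f B
  multilinear-vertex f [] x≈ = trans (+-identityʳ _) (*-identityʳ _)
  multilinear-vertex f (outside ∷ B) {x} x≈ = begin-equality
    multilinear f x                   ≈⟨ multilinear-cons f x ⟩
    (1# - x zero) * F₀ + x zero * F₁  ≈⟨ +-cong (*-congʳ (+-congˡ (trans (-‿cong (x≈ zero)) -0#≈0#))) (*-congʳ (x≈ zero)) ⟩
    (1# + 0#) * F₀ + 0# * F₁          ≈⟨ +-cong (trans (*-congʳ (+-identityʳ 1#)) (*-identityˡ F₀)) (zeroˡ F₁) ⟩
    F₀ + 0#                           ≈⟨ +-identityʳ F₀ ⟩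
    F₀                                ≈⟨ multilinear-vertex (f ∘ (outside ∷_)) B (x≈ ∘ suc) ⟩
    f (outside ∷ B)                   ∎
    where
    F₀ = multilinear (f ∘ (outside ∷_)) (x ∘ suc)
    F₁ = multilinear (f ∘ (inside  ∷_)) (x ∘ suc)
  multilinear-vertex f (inside ∷ B) {x} x≈ = begin-equality
    multilinear f x                   ≈⟨ multilinear-cons f x ⟩
    (1# - x zero) * F₀ + x zero * F₁  ≈⟨ +-cong (*-congʳ (+-congˡ (-‿cong (x≈ zero)))) (*-congʳ (x≈ zero)) ⟩
    (1# - 1#) * F₀ + 1# * F₁          ≈⟨ +-cong (trans (*-congʳ (-‿inverseʳ 1#)) (zeroˡ F₀)) (*-identityˡ F₁) ⟩
    0# + F₁                           ≈⟨ +-identityˡ F₁ ⟩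
    F₁                                ≈⟨ multilinear-vertex (f ∘ (inside ∷_)) B (x≈ ∘ suc) ⟩
    f (inside ∷ B)                    ∎
    where
    F₀ = multilinear (f ∘ (outside ∷_)) (x ∘ suc)
    F₁ = multilinear (f ∘ (inside  ∷_)) (x ∘ suc)

module SubmodularProperties {c ℓ₁ ℓ₂} (𝕂 : OrderedField c ℓ₁ ℓ₂) where
  open OrderedFieldProperties 𝕂
  open SetFunctions 𝕂

  ·-submodular : ∀ {n} {f : SetFunction n} m → Submodular f → Submodular (λ A → m · f A)
  ·-submodular m sub A B = ≤-trans (≤-reflexive (sym (×-distrib-+ _ _ m)))
    (≤-trans (·-monoʳ-≤ m (sub A B)) (≤-reflexive (×-distrib-+ _ _ m)))

  module _ {n} {f : SetFunction n} (sub : Submodular f) where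

    disjoint-submodular : ∀ {X Y} → Disjoint X Y → ∀ S → f S + f (X ∪ (Y ∪ S)) ≤ f (X ∪ S) + f (Y ∪ S)
    disjoint-submodular {X} {Y} X∩Y≡∅ S =
      ≡.subst₂ (λ A B → f A + f B ≤ f (X ∪ S) + f (Y ∪ S)) meet join (sub (X ∪ S) (Y ∪ S))
      where
      meet : (X ∪ S) ∩ (Y ∪ S) ≡ S
      meet = ≡.trans (≡.sym (∪-distribʳ-∩ S X Y)) (≡.trans (≡.cong (_∪ S) X∩Y≡∅) (∪-identityˡ S))
      join : (X ∪ S) ∪ (Y ∪ S) ≡ X ∪ (Y ∪ S)
      join = ≡.trans (∪-assoc X S (Y ∪ S)) (≡.cong (X ∪_)
        (≡.trans (≡.cong (S ∪_) (∪-comm Y S)) (≡.trans (≡.sym (∪-assoc S S Y))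
          (≡.trans (≡.cong (_∪ Y) (∪-idem S)) (∪-comm S Y)))))

    disjoint-cover : ∀ {Ss} → AllPairs Disjoint Ss → ∀ A →
      List.length Ss · f A + f (⋃ Ss ∪ A) ≤ f A + List.foldr _+_ 0# (List.map (λ S → f (S ∪ A)) Ss)
    disjoint-cover [] A = ≤-reflexive (trans (+-comm _ _)
      (+-congʳ (reflexive (≡.cong f (∪-identityˡ A)))))
    disjoint-cover {S ∷ Ss} (px ∷ pxs) A = begin
      (f A + l) + f ((S ∪ ⋃ Ss) ∪ A)    ≡⟨ ≡.cong (λ B → (f A + l) + f B) (∪-assoc S (⋃ Ss) A) ⟩
      (f A + l) + f (S ∪ (⋃ Ss ∪ A))    ≈⟨ solve 3 (λ x l y → (x :+ l) :+ y := l :+ (x :+ y)) refl _ l _ ⟩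
      l + (f A + f (S ∪ (⋃ Ss ∪ A)))    ≤⟨ +-monoʳ-≤ l (disjoint-submodular (disjoint-⋃ px) A) ⟩
      l + (f (S ∪ A) + f (⋃ Ss ∪ A))    ≈⟨ solve 3 (λ l x y → l :+ (x :+ y) := x :+ (l :+ y)) refl l _ _ ⟩
      f (S ∪ A) + (l + f (⋃ Ss ∪ A))    ≤⟨ +-monoʳ-≤ _ (disjoint-cover pxs A) ⟩
      f (S ∪ A) + (f A + Σ)             ≈⟨ solve 3 (λ x y s → x :+ (y :+ s) := y :+ (x :+ s)) refl _ _ Σ ⟩
      f A + (f (S ∪ A) + Σ)             ∎
      where
      l = List.length Ss · f A
      Σ = List.foldr _+_ 0# (List.map (λ S → f (S ∪ A)) Ss)

    MarginalAtMost : Carrier → Subset n → Fin n → Set ℓ₂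
    MarginalAtMost t S u = f (⁅ u ⁆ ∪ S) ≤ f S + t

    marginal-superset : ∀ {t S u} → MarginalAtMost t S u → ∀ {X} → u ∉ X → MarginalAtMost t (X ∪ S) u
    marginal-superset {t} {S} {u} small {X} u∉X = +-cancelʳ-≤ (f S) (begin
      f (⁅ u ⁆ ∪ (X ∪ S)) + f S  ≈⟨ +-comm _ _ ⟩
      f S + f (⁅ u ⁆ ∪ (X ∪ S))  ≤⟨ disjoint-submodular (∉⇒disjoint u∉X) S ⟩
      f (⁅ u ⁆ ∪ S) + f (X ∪ S)  ≤⟨ +-monoˡ-≤ (f (X ∪ S)) small ⟩
      (f S + t) + f (X ∪ S)      ≈⟨ solve 3 (λ x t y → (x :+ t) :+ y := (y :+ t) :+ x) refl (f S) t (f (X ∪ S)) ⟩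
      (f (X ∪ S) + t) + f S      ∎)

    -- Adding the elements of Z one by one, each marginal is at most t by submodularity.
    marginals-bound : ∀ {t} → 0# ≤ t → ∀ {S Y} k {Z} → ∣ Z ∣ ℕ.≤ k →
      (∀ {u} → u ∈ Z → u ∉ Y × MarginalAtMost t S u) → f (Z ∪ (Y ∪ S)) ≤ f (Y ∪ S) + k · t
    marginals-bound {t} 0≤t {S} {Y} k {Z} ∣Z∣≤k small with nonempty? Z
    ... | no Z-empty = begin
      f (Z ∪ (Y ∪ S))    ≡⟨ ≡.cong (λ Z → f (Z ∪ (Y ∪ S))) (Empty-unique Z-empty) ⟩
      f (∅ ∪ (Y ∪ S))    ≡⟨ ≡.cong f (∪-identityˡ (Y ∪ S)) ⟩
      f (Y ∪ S)          ≤⟨ x≤x+y (f (Y ∪ S)) (·-nonNegative k 0≤t) ⟩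
      f (Y ∪ S) + k · t  ∎
    marginals-bound {t} 0≤t {S} {Y} zero {Z} ∣Z∣≤k small | yes (x , x∈Z) =
      ⊥-elim (ℕ.n≮0 (ℕ.≤-trans (x∈p⇒∣p-x∣<∣p∣ x∈Z) ∣Z∣≤k))
    marginals-bound {t} 0≤t {S} {Y} (suc k) {Z} ∣Z∣≤k small | yes (x , x∈Z) = begin
      f (Z ∪ (Y ∪ S))                 ≡⟨ ≡.cong f regroup ⟨
      f (⁅ x ⁆ ∪ (((Z ∖ x) ∪ Y) ∪ S)) ≤⟨ marginal-superset (proj₂ (small x∈Z)) x∉ ⟩
      f (((Z ∖ x) ∪ Y) ∪ S) + t       ≡⟨ ≡.cong (λ B → f B + t) (∪-assoc (Z ∖ x) Y S) ⟩
      f ((Z ∖ x) ∪ (Y ∪ S)) + t       ≤⟨ +-monoˡ-≤ t (marginals-bound 0≤t k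
                                            (ℕ.≤-pred (ℕ.≤-trans (x∈p⇒∣p-x∣<∣p∣ x∈Z) ∣Z∣≤k))
                                            (small ∘ p─q⊆p Z ⁅ x ⁆)) ⟩
      (f (Y ∪ S) + k · t) + t         ≈⟨ solve 3 (λ a b c → (a :+ b) :+ c := a :+ (c :+ b)) refl _ (k · t) t ⟩
      f (Y ∪ S) + suc k · t           ∎
      where
      x∉Z-x : x ∉ Z ∖ x
      x∉Z-x x∈ = x∈p─q⇒x∉q x∈ (x∈⁅x⁆ x)
      x∉ : x ∉ (Z ∖ x) ∪ Y
      x∉ = [ x∉Z-x , proj₁ (small x∈Z) ]′ ∘ x∈p∪q⁻ (Z ∖ x) Y
      ⁅x⁆∪[Z-x]≡Z : ⁅ x ⁆ ∪ (Z ∖ x) ≡ Z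
      ⁅x⁆∪[Z-x]≡Z = ⊆-antisym
        (λ w∈ → [ (λ w∈x → ≡.subst (_∈ Z) (≡.sym (x∈⁅y⁆⇒x≡y x w∈x)) x∈Z) , p─q⊆p Z ⁅ x ⁆ ]′ (x∈p∪q⁻ ⁅ x ⁆ (Z ∖ x) w∈))
        (λ {w} w∈Z → x∈p∪q⁺ (case w w∈Z))
        where
        case : ∀ w → w ∈ Z → _
        case w w∈Z with w Fin.≟ x
        ... | yes ≡.refl = inj₁ (x∈⁅x⁆ x)
        ... | no  w≢x    = inj₂ (x∈p∧x≢y⇒x∈p-y w∈Z w≢x)
      regroup : ⁅ x ⁆ ∪ (((Z ∖ x) ∪ Y) ∪ S) ≡ Z ∪ (Y ∪ S)
      regroup = ≡.trans (≡.cong (⁅ x ⁆ ∪_) (∪-assoc (Z ∖ x) Y S))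
        (≡.trans (≡.sym (∪-assoc ⁅ x ⁆ (Z ∖ x) (Y ∪ S))) (≡.cong (_∪ (Y ∪ S)) ⁅x⁆∪[Z-x]≡Z))

Label : Set
Label = Bool × Bool

_≟ₗ_ : DecidableEquality Label
_≟ₗ_ = Product.≡-dec Bool._≟_ Bool._≟_

labels : List Label
labels = (false , false) ∷ (false , true) ∷ (true , false) ∷ (true , true) ∷ []

nextLabel : Label → Maybe Label
nextLabel (false , false) = just (false , true)
nextLabel (false , true)  = just (true , false)
nextLabel (true  , false) = just (true , true)
nextLabel (true  , true)  = nothing

bucket : ∀ {m} → Label → Subset m → Subset m → Subset m
bucket c = Vec.zipWith (λ x y → does ((x , y) ≟ₗ c))

∈-bucket : ∀ {m} c (a b : Subset m) {i} → i ∈ bucket c a b → (lookup a i , lookup b i) ≡ c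
∈-bucket c (x ∷ a) (y ∷ b) {zero} i∈ with (x , y) ≟ₗ c
∈-bucket c (x ∷ a) (y ∷ b) {zero} Vec.here | yes eq = eq
∈-bucket c (x ∷ a) (y ∷ b) {suc i} (Vec.there i∈) = ∈-bucket c a b i∈

bucket-sizes : ∀ {m} (a b : Subset m) → ListAction.sum (List.map (λ c → ∣ bucket c a b ∣) labels) ≡ m
bucket-sizes [] [] = ≡.refl
bucket-sizes (x ∷ a) (y ∷ b) with x | y | bucket-sizes a b
... | false | false | ih = ≡.cong suc ih
... | false | true  | ih = ≡.trans (ℕ.+-suc p _) (≡.cong suc ih)
  where p = ∣ bucket (false , false) a b ∣
... | true  | false | ih = ≡.trans (≡.cong (p ℕ.+_) (ℕ.+-suc q _)) (≡.trans (ℕ.+-suc p _) (≡.cong suc ih))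
  where p = ∣ bucket (false , false) a b ∣
        q = ∣ bucket (false , true) a b ∣
... | true  | true  | ih = ≡.trans (≡.cong (λ z → p ℕ.+ (q ℕ.+ z)) (ℕ.+-suc r _))
                          (≡.trans (≡.cong (p ℕ.+_) (ℕ.+-suc q _)) (≡.trans (ℕ.+-suc p _) (≡.cong suc ih)))
  where p = ∣ bucket (false , false) a b ∣
        q = ∣ bucket (false , true) a b ∣
        r = ∣ bucket (true , false) a b ∣

sum-map-≤ : ∀ {A : Set} (g : A → ℕ) {k} → (∀ x → g x ℕ.≤ k) → ∀ xs →
  ListAction.sum (List.map g xs) ℕ.≤ List.length xs ℕ.* k
sum-map-≤ g g≤k []       = ℕ.z≤n
sum-map-≤ g g≤k (x ∷ xs) = ℕ.+-mono-≤ (g≤k x) (sum-map-≤ g g≤k xs)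

pred : ∀ {m} → Subset m → Maybe (Subset m)
pred []            = nothing
pred (inside  ∷ s) = just (outside ∷ s)
pred (outside ∷ s) = Maybe.map (inside ∷_) (pred s)

value : ∀ {m} → Subset m → ℕ
value []            = 0
value (inside  ∷ s) = suc (2 ℕ.* value s)
value (outside ∷ s) = 2 ℕ.* value s

value-pred-just : ∀ {m} (s : Subset m) {t} → pred s ≡ just t → value s ≡ suc (value t)
value-pred-just (inside  ∷ s) ≡.refl = ≡.refl
value-pred-just (outside ∷ s) eq with pred s in eqₛ
value-pred-just (outside ∷ s) ≡.refl | just t =
  ≡.trans (≡.cong (2 ℕ.*_) (value-pred-just s eqₛ)) (ℕ.*-suc 2 (value t))

value-pred-nothing : ∀ {m} (s : Subset m) → pred s ≡ nothing → value s ≡ 0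
value-pred-nothing []            _  = ≡.refl
value-pred-nothing (outside ∷ s) eq with pred s in eqₛ
... | nothing = ≡.cong (2 ℕ.*_) (value-pred-nothing s eqₛ)

value-injective : ∀ {m} (s t : Subset m) → value s ≡ value t → s ≡ t
value-injective []            []            _  = ≡.refl
value-injective (inside  ∷ s) (inside  ∷ t) eq = ≡.cong (inside ∷_)
  (value-injective s t (ℕ.*-cancelˡ-≡ _ _ 2 (ℕ.suc-injective eq)))
value-injective (inside  ∷ s) (outside ∷ t) eq = ⊥-elim (ℕ.even≢odd (value t) (value s) (≡.sym eq))
value-injective (outside ∷ s) (inside  ∷ t) eq = ⊥-elim (ℕ.even≢odd (value s) (value t) eq)
value-injective (outside ∷ s) (outside ∷ t) eq = ≡.cong (outside ∷_)
  (value-injective s t (ℕ.*-cancelˡ-≡ _ _ 2 eq))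

value≤⊤ : ∀ {m} (s : Subset m) → value s ℕ.≤ value (⊤ {m})
value≤⊤ []            = ℕ.z≤n
value≤⊤ (inside  ∷ s) = ℕ.s≤s (ℕ.*-monoʳ-≤ 2 (value≤⊤ s))
value≤⊤ (outside ∷ s) = ℕ.m≤n⇒m≤1+n (ℕ.*-monoʳ-≤ 2 (value≤⊤ s))

pred-∅ : ∀ m → pred (∅ {m}) ≡ nothing
pred-∅ zero    = ≡.refl
pred-∅ (suc m) = ≡.cong (Maybe.map (inside ∷_)) (pred-∅ m)

truncate : ∀ {m} → ℕ → Subset m → Subset m
truncate k s = if does (∣ s ∣ ℕ.≤? k) then s else ∅

if-does : ∀ {a p q} {A : Set a} {P : Set p} (d : Dec P) (Φ : A → Set q) {x y} →
  (P → Φ x) → (¬ P → Φ y) → Φ (if does d then x else y)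
if-does (yes p) Φ then else = then p
if-does (no ¬p) Φ then else = else ¬p

truncate-feasible : ∀ {m} k (s : Subset m) → ∣ truncate k s ∣ ℕ.≤ k
truncate-feasible {m} k s = if-does (∣ s ∣ ℕ.≤? k) (λ t → ∣ t ∣ ℕ.≤ k)
  id (λ _ → ≡.subst (ℕ._≤ k) (≡.sym (∣⊥∣≡0 m)) ℕ.z≤n)

truncate-id : ∀ {m} k (s : Subset m) → ∣ s ∣ ℕ.≤ k → truncate k s ≡ s
truncate-id k s ∣s∣≤k = if-does (∣ s ∣ ℕ.≤? k) (_≡ s) (λ _ → ≡.refl) (λ ∣s∣≰k → ⊥-elim (∣s∣≰k ∣s∣≤k))

data Phase : Set where
  collecting offering rejecting comparing advancing : Phase

encode : Phase → Vec Bool 3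
encode collecting = true  ∷ true  ∷ true  ∷ []
encode offering   = false ∷ true  ∷ true  ∷ []
encode rejecting  = false ∷ false ∷ true  ∷ []
encode comparing  = false ∷ false ∷ false ∷ []
encode advancing  = true  ∷ false ∷ false ∷ []

decode : Vec Bool 3 → Phase
decode (true  ∷ true  ∷ _     ∷ _) = collecting
decode (false ∷ true  ∷ _     ∷ _) = offering
decode (false ∷ false ∷ true  ∷ _) = rejecting
decode (false ∷ false ∷ false ∷ _) = comparing
decode (true  ∷ false ∷ _     ∷ _) = advancing

decode-encode : ∀ p → decode (encode p) ≡ p
decode-encode collecting = ≡.refl
decode-encode offering   = ≡.refl
decode-encode rejecting  = ≡.refl
decode-encode comparing  = ≡.refl
decode-encode advancing  = ≡.refl

-- While the stream is read, the two bits of a slot are the label of its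
-- element (of the class being tried, for the newest element).  Afterwards the
-- first bits are the current and the second bits the best subset of the slots.
State : ℕ → ℕ → Set
State m r = Phase × Subset m × Subset m

vertex : ∀ {m} → Subset m → Vec UnitInterval m
vertex = Vec.map λ b → if b then unit 1ℚ (from-yes (0ℚ ℚ.≤? 1ℚ)) ℚ.≤-refl else unit 0ℚ ℚ.≤-refl (from-yes (0ℚ ℚ.≤? 1ℚ))

offer : ∀ {m r} → Label → Subset m → Subset m → Instruction State (suc m) r
offer c@(x , y) a b = query (vertex (outside ∷ bucket c a b)) (offering , x ∷ a , y ∷ b)

-- Since pred ∅ is nothing, advancing from ∅ halts at once and outputs the full class.
accepted : ∀ {m} → ℕ → Label → Subset m → Subset m → State (suc m) 2
accepted k c@(x , y) a b =
  if does (k ℕ.≤? suc ∣ bucket c a b ∣) then (advancing , ∅ , inside ∷ bucket c a b) else (collecting , x ∷ a , y ∷ b)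

instruction : ℕ → ∀ m r → State m r → Instruction State m r
instruction k m       0       (collecting , a , b)         = next (offering , outside ∷ a , outside ∷ b) (comparing , ⊤ , ∅)
instruction k m       (suc r) (collecting , a , b)         = erase zero (collecting , a , b)
instruction k (suc m) 0       (offering , x ∷ a , y ∷ b)   = offer (x , y) a b
instruction k (suc m) 1       (offering , x ∷ a , y ∷ b)   =
  query (vertex (inside ∷ bucket (x , y) a b)) (offering , x ∷ a , y ∷ b)
instruction k (suc m) 2       (offering , x ∷ a , y ∷ b)   =
  test (-[1+ 0 ]) (+ (4 ℕ.* k) ∷ ℤ.- (+ (4 ℕ.* k)) ∷ []) (accepted k (x , y) a b) (rejecting , x ∷ a , y ∷ b)
instruction k m       (suc r) (rejecting , a , b)          = erase zero (rejecting , a , b)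
instruction k (suc m) 0       (rejecting , x ∷ a , y ∷ b)  =
  maybe′ (λ c → offer c a b) (forget zero (collecting , a , b)) (nextLabel (x , y))
instruction k m       0       (comparing , a , b)          = query (vertex b) (comparing , a , b)
instruction k m       1       (comparing , a , b)          = query (vertex (truncate k a)) (comparing , a , b)
instruction k m       2       (comparing , a , b)          =
  test (+ 0) (+ 1 ∷ ℤ.- (+ 1) ∷ []) (advancing , a , truncate k a) (advancing , a , b)
instruction k m       (suc r) (advancing , a , b)          = erase zero (advancing , a , b)
instruction k m       0       (advancing , a , b)          =
  maybe′ (λ a → query (vertex b) (comparing , a , b)) (halt b) (pred a)
-- Only unreachable configurations remain.
instruction k m       r       _                            = halt ∅

algorithm : StreamingAlgorithm
algorithm = record
  { State          = State
  ; code           = λ (p , a , b) → Vec.toList (encode p Vec.++ a Vec.++ b)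
  ; code-injective = code-injective
  ; initial        = λ k → collecting , [] , []
  ; program        = λ k {m} {r} → instruction k m r
  }
  where
  code-injective : ∀ {m} {s t : Phase × Subset m × Subset m} →
    Vec.toList (encode (proj₁ s) Vec.++ proj₁ (proj₂ s) Vec.++ proj₂ (proj₂ s)) ≡
    Vec.toList (encode (proj₁ t) Vec.++ proj₁ (proj₂ t) Vec.++ proj₂ (proj₂ t)) → s ≡ t
  code-injective {s = p , a , b} {q , c , d} eq =
    ≡.cong₂ _,_ p≡q (≡.cong₂ _,_ (Vec.++-injectiveˡ a c rest) (Vec.++-injectiveʳ a c rest))
    where
    bits : encode p Vec.++ a Vec.++ b ≡ encode q Vec.++ c Vec.++ d
    bits = ≡.trans (≡.sym (Vec.cast-is-id ≡.refl _)) (Vec.toList-injective ≡.refl _ _ eq)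
    rest : a Vec.++ b ≡ c Vec.++ d
    rest = Vec.++-injectiveʳ (encode p) (encode q) bits
    p≡q : p ≡ q
    p≡q = ≡.trans (≡.sym (decode-encode p))
      (≡.trans (≡.cong decode (Vec.++-injectiveˡ (encode p) (encode q) bits)) (decode-encode q))

code-length : ∀ {m r} (s : State m r) → List.length (StreamingAlgorithm.code algorithm {m} {r} s) ≡ 3 ℕ.+ (m ℕ.+ m)
code-length (p , a , b) = Vec.length-toList (encode p Vec.++ a Vec.++ b)

memory-bound : ∀ {m r l k} log-k log-n → .{{ℕ.NonZero k}} → m ℕ.≤ 5 ℕ.* k → r ℕ.≤ 2 → l ≡ 3 ℕ.+ (m ℕ.+ m) →
  m ℕ.* (1 ℕ.+ log-n) ℕ.+ r ℕ.+ l ℕ.≤ 20 ℕ.* k ℕ.* (1 ℕ.+ log-k ℕ.+ log-n) ℕ.^ 1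
memory-bound {m} {r} {_} {k} log-k log-n m≤5k r≤2 ≡.refl = begin
  m ℕ.* L ℕ.+ r ℕ.+ (3 ℕ.+ (m ℕ.+ m))
    ≤⟨ ℕ.+-mono-≤ (ℕ.+-mono-≤ (ℕ.*-monoˡ-≤ L m≤5k) r≤2) (ℕ.+-monoʳ-≤ 3 (ℕ.+-mono-≤ m≤5k m≤5k)) ⟩
  5 ℕ.* k ℕ.* L ℕ.+ 2 ℕ.+ (3 ℕ.+ (5 ℕ.* k ℕ.+ 5 ℕ.* k))
    ≡⟨ ring₁ k L ⟩
  5 ℕ.* 1 ℕ.+ 5 ℕ.* k ℕ.* L ℕ.+ 10 ℕ.* k
    ≤⟨ ℕ.+-monoˡ-≤ _ (ℕ.+-monoˡ-≤ _ (ℕ.*-monoʳ-≤ 5 (ℕ.>-nonZero⁻¹ k))) ⟩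
  5 ℕ.* k ℕ.+ 5 ℕ.* k ℕ.* L ℕ.+ 10 ℕ.* k
    ≡⟨ ring₂ k L ⟩
  15 ℕ.* k ℕ.* 1 ℕ.+ 5 ℕ.* k ℕ.* L
    ≤⟨ ℕ.+-monoˡ-≤ _ (ℕ.*-monoʳ-≤ (15 ℕ.* k) (ℕ.s≤s ℕ.z≤n)) ⟩
  15 ℕ.* k ℕ.* L ℕ.+ 5 ℕ.* k ℕ.* L
    ≡⟨ ring₃ k L ⟩
  20 ℕ.* k ℕ.* L
    ≤⟨ ℕ.*-monoʳ-≤ (20 ℕ.* k) (ℕ.s≤s (ℕ.m≤n+m log-n log-k)) ⟩
  20 ℕ.* k ℕ.* (1 ℕ.+ log-k ℕ.+ log-n)
    ≡⟨ ≡.cong (20 ℕ.* k ℕ.*_) (ℕ.^-identityʳ _) ⟨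
  20 ℕ.* k ℕ.* (1 ℕ.+ log-k ℕ.+ log-n) ℕ.^ 1 ∎
  where
  open ℕ.≤-Reasoning
  L = 1 ℕ.+ log-n
  ring₁ : ∀ k L → 5 ℕ.* k ℕ.* L ℕ.+ 2 ℕ.+ (3 ℕ.+ (5 ℕ.* k ℕ.+ 5 ℕ.* k)) ≡ 5 ℕ.* 1 ℕ.+ 5 ℕ.* k ℕ.* L ℕ.+ 10 ℕ.* k
  ring₁ = ℕ.solve-∀
  ring₂ : ∀ k L → 5 ℕ.* k ℕ.+ 5 ℕ.* k ℕ.* L ℕ.+ 10 ℕ.* k ≡ 15 ℕ.* k ℕ.* 1 ℕ.+ 5 ℕ.* k ℕ.* L
  ring₂ = ℕ.solve-∀
  ring₃ : ∀ k L → 15 ℕ.* k ℕ.* L ℕ.+ 5 ℕ.* k ℕ.* L ≡ 20 ℕ.* k ℕ.* L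
  ring₃ = ℕ.solve-∀

∣⁅u⁆∪p∣≤1+∣p∣ : ∀ {n} (u : Fin n) p → ∣ ⁅ u ⁆ ∪ p ∣ ℕ.≤ suc ∣ p ∣
∣⁅u⁆∪p∣≤1+∣p∣ zero    (outside ∷ p) = ℕ.s≤s (ℕ.≤-reflexive (≡.cong ∣_∣ (∪-identityˡ p)))
∣⁅u⁆∪p∣≤1+∣p∣ zero    (inside  ∷ p) = ℕ.s≤s (ℕ.m≤n⇒m≤1+n (ℕ.≤-reflexive (≡.cong ∣_∣ (∪-identityˡ p))))
∣⁅u⁆∪p∣≤1+∣p∣ (suc u) (outside ∷ p) = ∣⁅u⁆∪p∣≤1+∣p∣ u p
∣⁅u⁆∪p∣≤1+∣p∣ (suc u) (inside  ∷ p) = ℕ.s≤s (∣⁅u⁆∪p∣≤1+∣p∣ u p)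

lookup-⁅u⁆∪ : ∀ {n} {u w : Fin n} p → w ≢ u → lookup (⁅ u ⁆ ∪ p) w ≡ lookup p w
lookup-⁅u⁆∪ {u = zero}  {zero}  (b ∷ p) w≢u = ⊥-elim (w≢u ≡.refl)
lookup-⁅u⁆∪ {u = zero}  {suc w} (b ∷ p) w≢u = ≡.cong (λ q → lookup q w) (∪-identityˡ p)
lookup-⁅u⁆∪ {u = suc u} {zero}  (b ∷ p) w≢u = ≡.refl
lookup-⁅u⁆∪ {u = suc u} {suc w} (b ∷ p) w≢u = lookup-⁅u⁆∪ p (w≢u ∘ ≡.cong suc)

lookup-∉ : ∀ {n} {u : Fin n} {p} → u ∉ p → lookup p u ≡ outside
lookup-∉ {u = u} {p} u∉p = Bool.¬-not (u∉p ∘ Vec.lookup⇒[]= u p)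

module Analysis
  {c ℓ₁ ℓ₂} (𝕂 : OrderedField c ℓ₁ ℓ₂) {n} (f : SetFunctions.SetFunction 𝕂 n)
  (f≥0 : SetFunctions.NonNegative 𝕂 f) (sub : SetFunctions.Submodular 𝕂 f)
  (k : ℕ) (k≢0 : ℕ.NonZero k) (OPT : Subset n) (∣OPT∣≤k : ∣ OPT ∣ ℕ.≤ k)
  (τ : OrderedField.Carrier 𝕂) (estimate : SetFunctions.IsEstimate 𝕂 (+ 9999 / 10000) τ (f OPT))
  where
  open OrderedFieldProperties 𝕂
  open SetFunctions 𝕂
  open MultilinearProperties 𝕂
  open SubmodularProperties 𝕂
  open Execution 𝕂 algorithm k (multilinear f) τ
  instance _ = k≢0

  0≤τ : 0# ≤ τ
  0≤τ = estimate-nonNegative (f≥0 OPT) (proj₁ estimate)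

  -- Scaling f by 4k turns the acceptance threshold τ / (4k) into τ.
  g : SetFunction n
  g A = (4 ℕ.* k) · f A

  g-submodular : Submodular g
  g-submodular = ·-submodular (4 ℕ.* k) sub

  Unprofitable : Subset n → Fin n → Set ℓ₂
  Unprofitable = MarginalAtMost g-submodular τ

  selection-∈⁻ : ∀ {m} (es : Vec (Fin n) m) p {u} → u ∈ selection es p → ∃ λ i → i ∈ p × lookup es i ≡ u
  selection-∈⁻ []       []            u∈ = ⊥-elim (∉⊥ u∈)
  selection-∈⁻ (e ∷ es) (outside ∷ p) u∈ = let (i , i∈p , eq) = selection-∈⁻ es p u∈ in suc i , Vec.there i∈p , eq
  selection-∈⁻ (e ∷ es) (inside  ∷ p) u∈ with x∈p∪q⁻ ⁅ e ⁆ (selection es p) u∈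
  ... | inj₁ u∈e = zero , Vec.here , ≡.sym (x∈⁅y⁆⇒x≡y e u∈e)
  ... | inj₂ u∈p = let (i , i∈p , eq) = selection-∈⁻ es p u∈p in suc i , Vec.there i∈p , eq

  selection-∈⁺ : ∀ {m} (es : Vec (Fin n) m) p {i} → i ∈ p → lookup es i ∈ selection es p
  selection-∈⁺ (e ∷ es) (inside  ∷ p) Vec.here       = x∈p∪q⁺ (inj₁ (x∈⁅x⁆ e))
  selection-∈⁺ (e ∷ es) (inside  ∷ p) (Vec.there i∈) = x∈p∪q⁺ (inj₂ (selection-∈⁺ es p i∈))
  selection-∈⁺ (e ∷ es) (outside ∷ p) (Vec.there i∈) = selection-∈⁺ es p i∈

  ∉-selection : ∀ {m u} {es : Vec (Fin n) m} → VecAll.All (u ≢_) es → ∀ p → u ∉ selection es p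
  ∉-selection {es = es} u≢ p u∈ = let (i , _ , eq) = selection-∈⁻ es p u∈ in VecAllₚ.lookup⁺ u≢ i (≡.sym eq)

  selection-disjoint : ∀ {m} {es : Vec (Fin n) m} → Vec.Unique es → ∀ {p q} → (∀ {i} → i ∈ p → i ∉ q) →
    Disjoint (selection es p) (selection es q)
  selection-disjoint {es = es} unique {p} {q} disj = Empty-unique λ (u , u∈) →
    let (u∈p , u∈q)    = x∈p∩q⁻ (selection es p) (selection es q) u∈
        (i , i∈p , eq) = selection-∈⁻ es p u∈p
        (j , j∈q , eq′) = selection-∈⁻ es q u∈q
    in disj i∈p (≡.subst (_∈ q) (VecUnique.lookup-injective unique j i (≡.trans eq′ (≡.sym eq))) j∈q)

  ∣selection∣≤ : ∀ {m} (es : Vec (Fin n) m) p → ∣ selection es p ∣ ℕ.≤ ∣ p ∣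
  ∣selection∣≤ []       []            = ℕ.≤-reflexive (∣⊥∣≡0 n)
  ∣selection∣≤ (e ∷ es) (outside ∷ p) = ∣selection∣≤ es p
  ∣selection∣≤ (e ∷ es) (inside  ∷ p) = ℕ.≤-trans (∣⁅u⁆∪p∣≤1+∣p∣ e (selection es p)) (ℕ.s≤s (∣selection∣≤ es p))

  ∣selection∣≥ : ∀ {m} {es : Vec (Fin n) m} → Vec.Unique es → ∀ p → ∣ p ∣ ℕ.≤ ∣ selection es p ∣
  ∣selection∣≥ []             []            = ℕ.z≤n
  ∣selection∣≥ (e≢ ∷ unique)  (outside ∷ p) = ∣selection∣≥ unique p
  ∣selection∣≥ {es = e ∷ es} (e≢ ∷ unique) (inside ∷ p) = ℕ.≤-<-trans (∣selection∣≥ unique p)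
    (p⊂q⇒∣p∣<∣q∣ (q⊆p∪q ⁅ e ⁆ (selection es p) , e , x∈p∪q⁺ (inj₁ (x∈⁅x⁆ e)) , ∉-selection e≢ p))

  point-vertex : ∀ {m} {es : Vec (Fin n) m} → Vec.Unique es → ∀ p u →
    point es (vertex p) u ≈ indicator (selection es p) u
  point-vertex []                          []      u = sym (reflexive (≡.cong (if_then 1# else 0#) (Vec.lookup-replicate u outside)))
  point-vertex {es = e ∷ es} (e≢ ∷ unique) (b ∷ p) u with u Fin.≟ e
  point-vertex {es = e ∷ es} (e≢ ∷ unique) (inside ∷ p) u | yes ≡.refl =
    trans fromℚ-1 (sym (reflexive (≡.cong (if_then 1# else 0#) (Vec.[]=⇒lookup (x∈p∪q⁺ {p = ⁅ e ⁆} (inj₁ (x∈⁅x⁆ e)))))))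
  point-vertex {es = e ∷ es} (e≢ ∷ unique) (outside ∷ p) u | yes ≡.refl =
    trans (zeroˡ _) (sym (reflexive (≡.cong (if_then 1# else 0#) (lookup-∉ (∉-selection e≢ p)))))
  point-vertex {es = e ∷ es} (e≢ ∷ unique) (inside ∷ p) u | no u≢e =
    trans (point-vertex unique p u) (sym (reflexive (≡.cong (if_then 1# else 0#) (lookup-⁅u⁆∪ (selection es p) u≢e))))
  point-vertex {es = e ∷ es} (e≢ ∷ unique) (outside ∷ p) u | no u≢e = point-vertex unique p u

  query-vertex : ∀ {m} {es : Vec (Fin n) m} → Vec.Unique es → ∀ p →
    multilinear f (point es (vertex p)) ≈ f (selection es p)
  query-vertex {es = es} unique p = multilinear-vertex f (selection es p) (point-vertex unique p)

  testValue : Carrier → ℕ → Carrier → Carrier → Carrier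
  testValue a b v w = a * τ + (fromℤ (+ b) * v + (fromℤ (ℤ.- (+ b)) * w + 0#))

  testValue-spec : ∀ a b s {v w x y} → a * τ + s ≈ 0# → v ≈ x → w ≈ y → testValue a b v w + (b · y + s) ≈ b · x
  testValue-spec a b s {v} {w} {x} {y} aτ+s≈0 v≈x w≈y = begin-equality
    testValue a b v w + (b · y + s)
      ≈⟨ +-cong (+-congˡ (+-cong (*-congˡ v≈x) (+-congʳ (*-cong (fromℤ-neg b) w≈y)))) (+-congʳ (n·x≈n·1*x b y)) ⟩
    (a * τ + (β * x + (- β * y + 0#))) + (β * y + s)
      ≈⟨ solve 6 (λ aτ s β γ x y → (aτ :+ (β :* x :+ (γ :* y :+ con 0))) :+ (β :* y :+ s) :=
                                    β :* x :+ ((aτ :+ s) :+ (γ :+ β) :* y)) refl (a * τ) s β (- β) x y ⟩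
    β * x + ((a * τ + s) + (- β + β) * y)
      ≈⟨ +-congˡ (+-cong aτ+s≈0 (trans (*-congʳ (-‿inverseˡ β)) (zeroˡ y))) ⟩
    β * x + (0# + 0#)
      ≈⟨ trans (+-congˡ (+-identityˡ 0#)) (+-identityʳ (β * x)) ⟩
    β * x
      ≈⟨ n·x≈n·1*x b x ⟨
    b · x ∎
    where β = b · 1#

  test-yes : ∀ a b s {v w x y} → a * τ + s ≈ 0# → v ≈ x → w ≈ y → 0# ≤ testValue a b v w → b · y + s ≤ b · x
  test-yes a b s {v} {w} {x} {y} aτ+s≈0 v≈x w≈y 0≤t = begin
    b · y + s                        ≈⟨ +-identityˡ _ ⟨
    0# + (b · y + s)                 ≤⟨ +-monoˡ-≤ _ 0≤t ⟩
    testValue a b v w + (b · y + s)  ≈⟨ testValue-spec a b s aτ+s≈0 v≈x w≈y ⟩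
    b · x                            ∎

  test-no : ∀ a b s {v w x y} → a * τ + s ≈ 0# → v ≈ x → w ≈ y → ¬ (0# ≤ testValue a b v w) → b · x ≤ b · y + s
  test-no a b s {v} {w} {x} {y} aτ+s≈0 v≈x w≈y 0≰t = begin
    b · x                            ≈⟨ testValue-spec a b s aτ+s≈0 v≈x w≈y ⟨
    testValue a b v w + (b · y + s)  ≤⟨ +-monoˡ-≤ _ (≰⇒≥ 0≰t) ⟩
    0# + (b · y + s)                 ≈⟨ +-identityˡ _ ⟩
    b · y + s                        ∎

  record Success (o : Outcome) : Set (c ⊔ ℓ₂) where
    field
      run           : Run o
      feasible      : AlwaysOutputs (Feasible k) run
      approximation : f OPT * fromℚ (+ 42819 / 10000) ⁻¹ ≤ expectation f run
      semiStreaming : Throughout (λ γ → Configuration.memory γ ℕ.≤ semiStreamingBound 20 1 k n) run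
      O[k]-elements : Throughout (λ γ → Configuration.storedElements γ ℕ.≤ 5 ℕ.* k) run

  succeed : ∀ {S} → Feasible k S → τ ≤ 4 · f S → Success (output S)
  succeed {S} feasible τ≤4f = record
    { run           = output S
    ; feasible      = feasible
    ; approximation = estimate⇒ratio (f≥0 S) (proj₁ estimate) τ≤4f
    ; semiStreaming = tt
    ; O[k]-elements = tt
    }

  proceed : ∀ {m r} {q : State m r} {es} {vs : Vec Carrier r} {us} → m ℕ.≤ 5 ℕ.* k → r ℕ.≤ 2 →
    Success (step ⟨ q , es , vs , us ⟩) → Success (continue ⟨ q , es , vs , us ⟩)
  proceed {m} {r} {q} m≤5k r≤2 s = record
    { run           = continue run
    ; feasible      = feasible
    ; approximation = approximation
    ; semiStreaming = memory-bound ⌈log₂ k ⌉ ⌈log₂ n ⌉ m≤5k r≤2 (code-length {m} {r} q) , semiStreaming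
    ; O[k]-elements = m≤5k , O[k]-elements
    }
    where open Success s

  0≤2 : 0 ℕ.≤ 2
  0≤2 = ℕ.z≤n
  1≤2 : 1 ℕ.≤ 2
  1≤2 = ℕ.s≤s ℕ.z≤n
  2≤2 : 2 ℕ.≤ 2
  2≤2 = ℕ.≤-refl

  data Clearing : Phase → Set where
    collecting : Clearing collecting
    rejecting  : Clearing rejecting
    advancing  : Clearing advancing

  erase-both : ∀ {p} → Clearing p → ∀ {m} {a b : Subset m} {es v w us} → m ℕ.≤ 5 ℕ.* k →
    Success (step ⟨ (p , a , b) , es , [] , us ⟩) → Success (continue ⟨ (p , a , b) , es , v ∷ w ∷ [] , us ⟩)
  erase-both collecting m≤5k s = proceed m≤5k 2≤2 (proceed m≤5k 1≤2 (proceed m≤5k 0≤2 s))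
  erase-both rejecting  m≤5k s = proceed m≤5k 2≤2 (proceed m≤5k 1≤2 (proceed m≤5k 0≤2 s))
  erase-both advancing  m≤5k s = proceed m≤5k 2≤2 (proceed m≤5k 1≤2 (proceed m≤5k 0≤2 s))

  module Search {m} (m≤5k : m ℕ.≤ 5 ℕ.* k) {es : Vec (Fin n) m} (unique : Vec.Unique es) {us : List (Fin n)}
    (suffices : ∀ {M} → (∀ p → ∣ p ∣ ℕ.≤ k → f (selection es p) ≤ M) → τ ≤ 4 · M) where

    BestFrom : ℕ → Subset m → Set ℓ₂
    BestFrom j best = ∀ p → j ℕ.≤ value p → f (selection es (truncate k p)) ≤ f (selection es best)

    advance : ∀ j cur {best} → value cur ≡ j → ∣ best ∣ ℕ.≤ k → BestFrom j best →
      Success (step ⟨ (advancing , cur , best) , es , [] , us ⟩)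
    compare : ∀ j cur {best v} → value cur ≡ j → ∣ best ∣ ℕ.≤ k → v ≈ f (selection es best) → BestFrom (suc j) best →
      Success (step ⟨ (comparing , cur , best) , es , v ∷ [] , us ⟩)

    advance j cur {best} val feasible isBest with pred cur in eq
    ... | nothing = succeed (ℕ.≤-trans (∣selection∣≤ es best) feasible) (suffices λ p ∣p∣≤k →
            ≡.subst (λ q → f (selection es q) ≤ f (selection es best)) (truncate-id k p ∣p∣≤k)
              (isBest p (≡.subst (ℕ._≤ value p) (≡.trans (≡.sym (value-pred-nothing cur eq)) val) ℕ.z≤n)))
    advance zero    cur val feasible isBest | just c = ⊥-elim (ℕ.0≢1+n (≡.trans (≡.sym val) (value-pred-just cur eq)))
    advance (suc j) cur {best} val feasible isBest | just c = proceed m≤5k 1≤2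
      (compare j c (ℕ.suc-injective (≡.trans (≡.sym (value-pred-just cur eq)) val)) feasible (query-vertex unique best) isBest)

    compare j cur {best} {v} val feasible v≈ isBest = proceed m≤5k 2≤2
      (if-does (0# ≤? _) (λ q → Success (continue ⟨ q , es , _ , us ⟩))
        (λ 0≤t → erase-both advancing m≤5k (advance j cur val (truncate-feasible k cur) (extend ≤-refl λ p j<p →
          ≤-trans (isBest p j<p)
          (≤-trans (≤-reflexive (sym (trans (+-identityʳ _) (+-identityʳ _))))
            (≤-trans (test-yes 0# 1 0# 0τ+0≈0 new≈ v≈ 0≤t) (≤-reflexive (+-identityʳ _)))))))
        (λ 0≰t → erase-both advancing m≤5k (advance j cur val feasible (extend
          (≤-trans (≤-reflexive (sym (+-identityʳ _)))
            (≤-trans (test-no 0# 1 0# 0τ+0≈0 new≈ v≈ 0≰t) (≤-reflexive (trans (+-identityʳ _) (+-identityʳ _)))))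
          isBest))))
      where
      0τ+0≈0 : 0# * τ + 0# ≈ 0#
      0τ+0≈0 = trans (+-identityʳ _) (zeroˡ τ)
      new≈ : multilinear f (point es (vertex (truncate k cur))) ≈ f (selection es (truncate k cur))
      new≈ = query-vertex unique (truncate k cur)
      extend : ∀ {b} → f (selection es (truncate k cur)) ≤ f (selection es b) → BestFrom (suc j) b → BestFrom j b
      extend cur≤ above p j≤p with ℕ.m≤n⇒m<n∨m≡n j≤p
      ... | inj₁ j<p = above p j<p
      ... | inj₂ j≡p = ≡.subst (λ q → f (selection es (truncate k q)) ≤ _) (value-injective cur p (≡.trans val j≡p)) cur≤

  quarter-bound : (S : Label → Subset n) → AllPairs Disjoint (List.map S labels) → ∀ {Y M} → Y ⊆ OPT →
    (∀ c {u} → u ∈ OPT → u ∉ Y → Unprofitable (S c) u) →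
    (∀ c → f (S c) ≤ M) → f Y ≤ M → τ ≤ 4 · M
  quarter-bound S disjoint {Y} {M} Y⊆OPT unprofitable S≤M Y≤M =
    ·-cancelˡ-≤ (4 ℕ.* k) {{ℕ.m*n≢0 4 k}} (·-cancelˡ-≤ 2 (+-cancelʳ-≤ (o + o) (begin
      2 · t + (o + o)                          ≤⟨ +-monoˡ-≤ (o + o) (·-monoʳ-≤ 2 t≤o) ⟩
      2 · o + (o + o)                          ≈⟨ solve 1 (λ o → (o :+ (o :+ con 0)) :+ (o :+ o) :=
                                                     o :+ (o :+ (o :+ (o :+ con 0)))) refl o ⟩
      4 · o                                    ≤⟨ x≤x+y (4 · o) (g≥0 _) ⟩
      4 · o + g (⋃ (List.map S labels) ∪ OPT)  ≤⟨ disjoint-cover g-submodular disjoint OPT ⟩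
      o + _                                    ≤⟨ +-monoʳ-≤ o (+-mono-≤ (bound _) (+-mono-≤ (bound _)
                                                     (+-mono-≤ (bound _) (+-monoˡ-≤ 0# (bound _))))) ⟩
      o + 4 · (G + G + k · τ)                  ≈⟨ +-congˡ (trans (×-distrib-+ (G + G) (k · τ) 4)
                                                     (+-congˡ (×-assocˡ τ 4 k))) ⟩
      o + (4 · (G + G) + t)                    ≤⟨ +-monoʳ-≤ o (+-monoʳ-≤ (4 · (G + G)) t≤o) ⟩
      o + (4 · (G + G) + o)                    ≈⟨ +-congˡ (+-congʳ (×-distrib-+ G G 4)) ⟩
      o + ((4 · G + 4 · G) + o)                ≈⟨ solve 2 (λ o h → o :+ ((h :+ h) :+ o) :=
                                                     (h :+ (h :+ con 0)) :+ (o :+ o)) refl o (4 · G) ⟩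
      2 · (4 · G) + (o + o)                    ≈⟨ +-congʳ (×-congʳ 2 (trans (×-assocˡ M 4 (4 ℕ.* k))
                                                     (trans (×-congˡ (ℕ.*-comm 4 (4 ℕ.* k))) (sym (×-assocˡ M (4 ℕ.* k) 4))))) ⟩
      2 · ((4 ℕ.* k) · (4 · M)) + (o + o)      ∎)))
    where
    o = g OPT
    t = (4 ℕ.* k) · τ
    G = (4 ℕ.* k) · M
    t≤o : t ≤ o
    t≤o = ·-monoʳ-≤ (4 ℕ.* k) (proj₂ estimate)
    g≥0 : ∀ A → 0# ≤ g A
    g≥0 A = ·-nonNegative (4 ℕ.* k) (f≥0 A)
    split : ∀ A → (OPT ─ Y) ∪ (Y ∪ A) ≡ A ∪ OPT
    split A = ≡.trans (≡.sym (∪-assoc (OPT ─ Y) Y A)) (≡.trans (≡.cong (_∪ A) (⊆-antisym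
      ([ p─q⊆p OPT Y , Y⊆OPT ]′ ∘ x∈p∪q⁻ (OPT ─ Y) Y) (x∈p∪q⁺ ∘ classify _))) (∪-comm OPT A))
      where
      classify : ∀ u → u ∈ OPT → u ∈ OPT ─ Y ⊎ u ∈ Y
      classify u u∈OPT with u ∈? Y
      ... | yes u∈Y = inj₂ u∈Y
      ... | no  u∉Y = inj₁ (x∈p∧x∉q⇒x∈p─q u∈OPT u∉Y)
    bound : ∀ c → g (S c ∪ OPT) ≤ G + G + k · τ
    bound c = begin
      g (S c ∪ OPT)                      ≡⟨ ≡.cong g (split (S c)) ⟨
      g ((OPT ─ Y) ∪ (Y ∪ S c))          ≤⟨ marginals-bound g-submodular 0≤τ k
                                              (ℕ.≤-trans (∣p─q∣≤∣p∣ OPT Y) ∣OPT∣≤k)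
                                              (λ u∈ → x∈p─q⇒x∉q u∈ , unprofitable c (p─q⊆p OPT Y u∈) (x∈p─q⇒x∉q u∈)) ⟩
      g (Y ∪ S c) + k · τ                ≤⟨ +-monoˡ-≤ (k · τ) (begin
        g (Y ∪ S c)                ≤⟨ x≤x+y (g (Y ∪ S c)) (g≥0 (Y ∩ S c)) ⟩
        g (Y ∪ S c) + g (Y ∩ S c)  ≈⟨ +-comm _ _ ⟩
        g (Y ∩ S c) + g (Y ∪ S c)  ≤⟨ g-submodular Y (S c) ⟩
        g Y + g (S c)              ≤⟨ +-mono-≤ (·-monoʳ-≤ (4 ℕ.* k) Y≤M) (·-monoʳ-≤ (4 ℕ.* k) (S≤M c)) ⟩
        G + G                      ∎) ⟩
      (G + G) + k · τ                    ∎

  record Invariant {m} (a b : Subset m) (es : Vec (Fin n) m) (us : List (Fin n)) : Set ℓ₂ where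
    class : Label → Subset n
    class c = selection es (bucket c a b)
    field
      stored-unique : Vec.Unique es
      unread-unique : Unique us
      unread-fresh  : All (λ u → VecAll.All (u ≢_) es) us
      not-full      : ∀ c → ∣ bucket c a b ∣ ℕ.< k
      profitable    : ∀ c → ∣ bucket c a b ∣ · τ ≤ g (class c)
      accounted     : ∀ u → (∃ λ i → lookup es i ≡ u) ⊎ u List.∈ us ⊎ (∀ c → Unprofitable (class c) u)

    slots-bound : suc m ℕ.≤ 5 ℕ.* k
    slots-bound = ℕ.+-mono-≤ (ℕ.>-nonZero⁻¹ k) (≡.subst (ℕ._≤ 4 ℕ.* k) (bucket-sizes a b)
      (sum-map-≤ (λ c → ∣ bucket c a b ∣) (λ c → ℕ.<⇒≤ (not-full c)) labels))

  labels-unique : Unique labels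
  labels-unique = ((λ ()) ∷ (λ ()) ∷ (λ ()) ∷ []) ∷ ((λ ()) ∷ (λ ()) ∷ []) ∷ ((λ ()) ∷ []) ∷ [] ∷ []

  invariant⇒suffices : ∀ {m} {a b : Subset m} {es} → Invariant a b es [] →
    ∀ {M} → (∀ p → ∣ p ∣ ℕ.≤ k → f (selection es p) ≤ M) → τ ≤ 4 · M
  invariant⇒suffices {m} {a} {b} {es} inv {M} all≤M = quarter-bound class
    (AllPairsₚ.map⁺ (AllPairs.map disjoint labels-unique)) Y⊆OPT unprofitable
    (λ c → all≤M (bucket c a b) (ℕ.<⇒≤ (not-full c)))
    (all≤M T (ℕ.≤-trans (∣selection∣≥ stored-unique T) (ℕ.≤-trans (p⊆q⇒∣p∣≤∣q∣ Y⊆OPT) ∣OPT∣≤k)))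
    where
    open Invariant inv
    T : Subset m
    T = Vec.map (lookup OPT) es
    disjoint : ∀ {c d} → c ≢ d → Disjoint (class c) (class d)
    disjoint c≢d = selection-disjoint stored-unique λ i∈c i∈d →
      c≢d (≡.trans (≡.sym (∈-bucket _ a b i∈c)) (∈-bucket _ a b i∈d))
    Y⊆OPT : selection es T ⊆ OPT
    Y⊆OPT u∈ with selection-∈⁻ es T u∈
    ... | i , i∈T , ≡.refl = Vec.lookup⇒[]= _ OPT
      (≡.trans (≡.sym (Vec.lookup-map i (lookup OPT) es)) (Vec.[]=⇒lookup i∈T))
    unprofitable : ∀ c {u} → u ∈ OPT → u ∉ selection es T → Unprofitable (class c) u
    unprofitable c {u} u∈OPT u∉Y with accounted u
    ... | inj₁ (i , ≡.refl) = ⊥-elim (u∉Y (selection-∈⁺ es T (Vec.lookup⇒[]= i T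
      (≡.trans (Vec.lookup-map i (lookup OPT) es) (Vec.[]=⇒lookup u∈OPT)))))
    ... | inj₂ (inj₂ small) = small c

  full-suffices : ∀ {A} → k · τ ≤ g A → τ ≤ 4 · f A
  full-suffices {A} kτ≤g = ·-cancelˡ-≤ k (≤-trans kτ≤g (≤-reflexive
    (trans (×-congˡ (ℕ.*-comm 4 k)) (sym (×-assocˡ (f A) k 4)))))

  module Arrival {m} {a b : Subset m} {es : Vec (Fin n) m} {u us} (inv : Invariant a b es (u ∷ us)) where
    open Invariant inv

    u-fresh : VecAll.All (u ≢_) es
    u-fresh = All.head unread-fresh

    arrived-unique : Vec.Unique (u ∷ es)
    arrived-unique = u-fresh ∷ stored-unique

    tail-fresh : All (λ w → VecAll.All (w ≢_) (u ∷ es)) us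
    tail-fresh = All.zipWith (λ (u≢w , fresh) → (u≢w ∘ ≡.sym) VecAll.∷ fresh)
      (AllPairs.head unread-unique , All.tail unread-fresh)

    rejected : (∀ c → Unprofitable (class c) u) → Invariant a b es us
    rejected small = record
      { stored-unique = stored-unique
      ; unread-unique = AllPairs.tail unread-unique
      ; unread-fresh  = All.tail unread-fresh
      ; not-full      = not-full
      ; profitable    = profitable
      ; accounted     = λ w → account w (accounted w)
      }
      where
      account : ∀ w → (∃ λ i → lookup es i ≡ w) ⊎ w List.∈ (u ∷ us) ⊎ (∀ c → Unprofitable (class c) w) →
                      (∃ λ i → lookup es i ≡ w) ⊎ w List.∈ us ⊎ (∀ c → Unprofitable (class c) w)
      account w (inj₁ stored)                      = inj₁ stored
      account w (inj₂ (inj₁ (Any.here ≡.refl)))    = inj₂ (inj₂ small)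
      account w (inj₂ (inj₁ (Any.there w∈us)))     = inj₂ (inj₁ w∈us)
      account w (inj₂ (inj₂ small))                = inj₂ (inj₂ small)

    gain : ∀ c → g (class c) + τ ≤ g (⁅ u ⁆ ∪ class c) → suc ∣ bucket c a b ∣ · τ ≤ g (⁅ u ⁆ ∪ class c)
    gain c large = begin
      τ + ∣ bucket c a b ∣ · τ  ≤⟨ +-monoʳ-≤ τ (profitable c) ⟩
      τ + g (class c)           ≈⟨ +-comm τ _ ⟩
      g (class c) + τ           ≤⟨ large ⟩
      g (⁅ u ⁆ ∪ class c)       ∎

    accepted-invariant : ∀ x y → suc ∣ bucket (x , y) a b ∣ ℕ.< k →
      g (class (x , y)) + τ ≤ g (⁅ u ⁆ ∪ class (x , y)) → Invariant (x ∷ a) (y ∷ b) (u ∷ es) us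
    accepted-invariant x y room large = record
      { stored-unique = arrived-unique
      ; unread-unique = AllPairs.tail unread-unique
      ; unread-fresh  = tail-fresh
      ; not-full      = not-full′
      ; profitable    = profitable′
      ; accounted     = λ w → account w (accounted w)
      }
      where
      not-full′ : ∀ d → ∣ bucket d (x ∷ a) (y ∷ b) ∣ ℕ.< k
      not-full′ d with (x , y) ≟ₗ d
      ... | yes ≡.refl = room
      ... | no  _      = not-full d
      profitable′ : ∀ d → ∣ bucket d (x ∷ a) (y ∷ b) ∣ · τ ≤ g (selection (u ∷ es) (bucket d (x ∷ a) (y ∷ b)))
      profitable′ d with (x , y) ≟ₗ d
      ... | yes ≡.refl = gain (x , y) large
      ... | no  _      = profitable d
      unprofitable′ : ∀ {w} → w ≢ u → (∀ d → Unprofitable (class d) w) →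
        ∀ d → Unprofitable (selection (u ∷ es) (bucket d (x ∷ a) (y ∷ b))) w
      unprofitable′ w≢u small d with (x , y) ≟ₗ d
      ... | yes ≡.refl = marginal-superset g-submodular (small d) (x≢y⇒x∉⁅y⁆ w≢u)
      ... | no  _      = small d
      account : ∀ w → (∃ λ i → lookup es i ≡ w) ⊎ w List.∈ (u ∷ us) ⊎ (∀ d → Unprofitable (class d) w) →
        (∃ λ i → lookup (u ∷ es) i ≡ w) ⊎ w List.∈ us ⊎
        (∀ d → Unprofitable (selection (u ∷ es) (bucket d (x ∷ a) (y ∷ b))) w)
      account w (inj₁ (i , eq))                    = inj₁ (suc i , eq)
      account w (inj₂ (inj₁ (Any.here ≡.refl)))    = inj₁ (zero , ≡.refl)
      account w (inj₂ (inj₁ (Any.there w∈us)))     = inj₂ (inj₁ w∈us)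
      account w (inj₂ (inj₂ small)) with w Fin.≟ u
      ... | yes ≡.refl = inj₁ (zero , ≡.refl)
      ... | no  w≢u    = inj₂ (inj₂ (unprofitable′ w≢u small))

    offered : ∀ x y {v} → v ≈ f (class (x , y)) →
      (Invariant (x ∷ a) (y ∷ b) (u ∷ es) us → Success (step ⟨ (collecting , x ∷ a , y ∷ b) , u ∷ es , [] , us ⟩)) →
      (Unprofitable (class (x , y)) u → Success (step ⟨ (rejecting , x ∷ a , y ∷ b) , u ∷ es , [] , us ⟩)) →
      Success (step ⟨ (offering , x ∷ a , y ∷ b) , u ∷ es , v ∷ [] , us ⟩)
    offered x y {v} v≈ onAccept onReject = proceed slots-bound 2≤2
      (if-does (0# ≤? _) (λ q → Success (continue ⟨ q , u ∷ es , _ ∷ v ∷ [] , us ⟩))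
        (λ 0≤t → accept (test-yes (fromℤ -[1+ 0 ]) (4 ℕ.* k) τ -τ+τ≈0 new≈ v≈ 0≤t))
        (λ 0≰t → erase-both rejecting slots-bound
          (onReject (test-no (fromℤ -[1+ 0 ]) (4 ℕ.* k) τ -τ+τ≈0 new≈ v≈ 0≰t))))
      where
      p = bucket (x , y) a b
      -τ+τ≈0 : fromℤ -[1+ 0 ] * τ + τ ≈ 0#
      -τ+τ≈0 = trans (+-congʳ (trans (*-congʳ (-‿cong (+-identityʳ 1#))) (-1*x≈-x τ))) (-‿inverseˡ τ)
      new≈ : multilinear f (point (u ∷ es) (vertex (inside ∷ p))) ≈ f (⁅ u ⁆ ∪ class (x , y))
      new≈ = query-vertex arrived-unique (inside ∷ p)
      halted : ∀ {A} → Feasible k A → τ ≤ 4 · f A → A ≡ selection (u ∷ es) (inside ∷ p) →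
        Success (step ⟨ (advancing , ∅ , inside ∷ p) , u ∷ es , [] , us ⟩)
      halted feasible τ≤4f ≡.refl rewrite pred-∅ m = succeed feasible τ≤4f
      accept : ∀ {vs : Vec Carrier 2} → g (class (x , y)) + τ ≤ g (⁅ u ⁆ ∪ class (x , y)) →
        Success (continue ⟨ accepted k (x , y) a b , u ∷ es , vs , us ⟩)
      accept {_ ∷ _ ∷ []} large = if-does (k ℕ.≤? suc ∣ p ∣) (λ q → Success (continue ⟨ q , u ∷ es , _ ∷ _ ∷ [] , us ⟩))
        (λ k≤1+∣p∣ → erase-both advancing slots-bound
          (halted (ℕ.≤-trans (∣selection∣≤ (u ∷ es) (inside ∷ p)) (not-full (x , y)))
                  (full-suffices (≤-trans (·-monoˡ-≤ 0≤τ k≤1+∣p∣) (gain (x , y) large))) ≡.refl))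
        (λ k≰1+∣p∣ → erase-both collecting slots-bound
          (onAccept (accepted-invariant x y (ℕ.≰⇒> k≰1+∣p∣) large)))

  collect : ∀ us {m} {a b : Subset m} {es} → Invariant a b es us →
    Success (step ⟨ (collecting , a , b) , es , [] , us ⟩)
  collect [] {m} {es = es} inv = proceed m≤5k 0≤2 (proceed m≤5k 1≤2
    (compare (value (⊤ {m})) ⊤ ≡.refl (≡.subst (ℕ._≤ k) (≡.sym (∣⊥∣≡0 m)) ℕ.z≤n) (query-vertex stored-unique ∅)
      (λ p ⊤<p → ⊥-elim (ℕ.<⇒≱ ⊤<p (value≤⊤ p)))))
    where
    open Invariant inv
    m≤5k : m ℕ.≤ 5 ℕ.* k
    m≤5k = ℕ.<⇒≤ slots-bound
    open Search m≤5k stored-unique {[]} (invariant⇒suffices inv)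
  collect (u ∷ us) {m} {a} {b} {es} inv = proceed slots-bound 0≤2
    (try (false , false) λ r₀ → try (false , true) λ r₁ → try (true , false) λ r₂ → try (true , true) λ r₃ →
      proceed (ℕ.<⇒≤ slots-bound) 0≤2 (collect us (rejected λ where
        (false , false) → r₀
        (false , true)  → r₁
        (true  , false) → r₂
        (true  , true)  → r₃)))
    where
    open Invariant inv
    open Arrival inv
    try : ∀ c →
      (Unprofitable (class c) u → Success (step ⟨ (rejecting , proj₁ c ∷ a , proj₂ c ∷ b) , u ∷ es , [] , us ⟩)) →
      Success (continue ⟨ (offering , proj₁ c ∷ a , proj₂ c ∷ b) , u ∷ es ,
        multilinear f (point (u ∷ es) (vertex (outside ∷ bucket c a b))) ∷ [] , us ⟩)
    try c@(x , y) onReject = proceed slots-bound 1≤2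
      (offered x y (query-vertex arrived-unique (outside ∷ bucket c a b)) (collect us) onReject)

  initially : (σ : Permutation′ n) → Invariant [] [] [] (List.tabulate (σ ⟨$⟩ʳ_))
  initially σ = record
    { stored-unique = []
    ; unread-unique = Unique.tabulate⁺ λ {i} {j} eq →
        ≡.trans (≡.sym (inverseˡ σ)) (≡.trans (≡.cong (σ ⟨$⟩ˡ_) eq) (inverseˡ σ))
    ; unread-fresh  = All.universal (λ _ → VecAll.[]) _
    ; not-full      = λ c → ℕ.>-nonZero⁻¹ k
    ; profitable    = λ c → ·-nonNegative (4 ℕ.* k) (f≥0 ∅)
    ; accounted     = λ u → inj₂ (inj₁ (≡.subst (List._∈ _) (inverseʳ σ) (List.∈-tabulate⁺ (σ ⟨$⟩ˡ u))))
    }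

  guarantee : (σ : Permutation′ n) → Guarantee 𝕂 algorithm (+ 42819 / 10000) 5 20 1 f k OPT τ σ
  guarantee σ = record { Success (proceed {q = collecting , [] , []} ℕ.z≤n 0≤2 (collect _ (initially σ))) }

open SetFunctions

theorem3p10 : ∀ {c ℓ₁ ℓ₂} (𝕂 : OrderedField c ℓ₁ ℓ₂) →
    Σ[ alg ∈ StreamingAlgorithm ] Σ[ B ∈ ℕ ] Σ[ C ∈ ℕ ] Σ[ d ∈ ℕ ]
    (∀ {n : ℕ} (f : SetFunction 𝕂 n) → NonNegative 𝕂 f → Submodular 𝕂 f →
    ∀ (k : ℕ) → NonZero k →
    ∀ (OPT : Subset n) → IsOptimal 𝕂 f k OPT →
    ∀ (τ : OrderedField.Carrier 𝕂) → IsEstimate 𝕂 (+ 9999 / 10000) τ (f OPT) →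
    ∀ (σ : Permutation′ n) →
    Guarantee 𝕂 alg (+ 42819 / 10000) B C d f k OPT τ σ)
theorem3p10 𝕂 = algorithm , 5 , 20 , 1 , λ f f≥0 sub k k≢0 OPT (∣OPT∣≤k , _) τ estimate σ →
  Analysis.guarantee 𝕂 f f≥0 sub k k≢0 OPT ∣OPT∣≤k τ estimate σ
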